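{- Let $F$ be a number field Galois over $\mathbb Q$, $M$ an even integer divisible by the discriminant of $F$, $\mathcal O=\mathcal O_F[1/M]$, $p$ a prime not dividing $M$, $\mathfrak P$ a prime of $\mathcal O$ above $p$, with Frobenius element $\phi_p\in\mathrm{Gal}(F/\mathbb Q)$. Let $\sigma_1=\mathrm{id},\sigma_2\in\mathrm{Gal}(F/\mathbb Q)$ be a vertical gauge, and let $d\in\mathcal O^\times$ be vertical gauge invariant, i.e. $\sigma_2(d)=d$. Let $E'=F(\alpha,\beta)$ with $\alpha,\beta$ indeterminates, and let $E'''=F(t)\subset E'$, $t=\alpha/\beta$. For $i=1,2$ let $\Gamma'_{pi}$ be the correspondence on $\mathrm{Spec}\,E'$ attached to $d$ (see context). Then there exist categorically reduced correspondences $\Gamma'''_{pi}$ in $\mathcal C_0(E''')$, $$\mathrm{Spec}\,E'''\xleftarrow{\ \pi'''_p\ }Y'''_{p/E'''}\xrightarrow{\ \varphi'''_{pi}\ }\mathrm{Spec}\,E''',\qquad i=1,2,$$ equipped with morphisms from $\Gamma'_{pi}$ to $\Gamma'''_{pi}$ extending the inclusion $E'''\subset E'$. Moreover, up to isomorphisms in $\mathcal C_0(E''')$, the categorically reduced correspondences $\Gamma'''_{pi}$ and the morphisms from $\Gamma'_{pi}$ to $\Gamma'''_{pi}$ are unique.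
   Context: Correspondences. A correspondence on a scheme $X$ is a diagram $\Gamma=(Y,\pi,\varphi)$: $X\xleftarrow{\pi}Y\xrightarrow{\varphi}X$ of schemes. A morphism $(Y',\pi',\varphi')\to(Y,\pi,\varphi)$ of correspondences on $X$ is a morphism $v:Y'\to Y$ with $\pi'=\pi\circ v$, $\varphi'=\varphi\circ v$. Given a morphism $u:X'\to X$, a correspondence $\Gamma'=(Y',\pi',\varphi')$ on $X'$ and a correspondence $\Gamma=(Y,\pi,\varphi)$ on $X$, a morphism from $\Gamma'$ to $\Gamma$ extending $u$ is a morphism of correspondences on $X$ from $(Y',u\circ\pi',u\circ\varphi')$ to $\Gamma$, i.e. a morphism of schemes $v:Y'\to Y$ with $\pi\circ v=u\circ\pi'$, $\varphi\circ v=u\circ\varphi'$. Here $u:\mathrm{Spec}\,E'\to\mathrm{Spec}\,E'''$ is the morphism induced by the inclusion $E'''\subset E'$. For a field $E$ of characteristic $0$, $\mathcal C_0(E)$ is the category whose objects are correspondences $(Y,\pi,\varphi)$ on $\mathrm{Spec}\,E$ such that $Y$ is the spectrum of a finite product of fields that are finite extensions of $E$ via $\pi$ (so $\pi$ is étale) and $\varphi$ is finite, and whose morphisms are the morphisms of correspondences $v$ which are surjective. A correspondence $\Gamma$ in $\mathcal C_0(E)$ (not necessarily with $Y$ irreducible) is categorically reduced if every morphism $\Gamma\to\Gamma'$ in $\mathcal C_0(E)$ is an isomorphism. If $Y=\mathrm{Spec}\,L$ with $L$ a field, this means that $L$ is the compositum of $\pi(E)$ and $\varphi(E)$; in general it means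 that all the irreducible components of $\Gamma$ (the correspondences defined by the connected components of $Y$) are categorically reduced and no two of them are isomorphic in $\mathcal C_0(E)$. The correspondences $\Gamma'_{pi}$ (the generic-point version of the algebraization of the arithmetic Levi-Civita connection attached to $q=d\cdot 1_2$) are explicitly the following. Let $$\theta_p=\frac{d^p(\alpha^2+\beta^2)^p}{\phi_p(d)(\alpha^{2p}+\beta^{2p})}\in E'.$$ Let $L'_p=E'(v_p)$ be the field generated over $E'$ by a root $v_p$ of the (irreducible) polynomial $2z^2+2z+1-\theta_p$, and $u_p=1+v_p$. Then $\Gamma'_{pi}=(\mathrm{Spec}\,L'_p,\pi'_p,\varphi'_{pi})$ where $\pi'_p$ corresponds to the inclusion $E'\subset L'_p$ and $\varphi'_{p1},\varphi'_{p2}$ correspond to the field homomorphisms $E'\to L'_p$ acting on $F$ via $\phi_p$ and given on $\alpha,\beta$ by $$\varphi'_{p1}\begin{pmatrix}\alpha&\beta\\ -\beta&\alpha\end{pmatrix}=\begin{pmatrix}\alpha^p&\beta^p\\ -\beta^p&\alpha^p\end{pmatrix}\begin{pmatrix}u_p&v_p\\ -v_p&u_p\end{pmatrix},\quad \varphi'_{p2}\begin{pmatrix}\alpha&\beta\\ -\beta&\alpha\end{pmatrix}=\begin{pmatrix}\alpha^p&\beta^p\\ -\beta^p&\alpha^p\end{pmatrix}\begin{pmatrix}u_p&-v_p\\ v_p&u_p\end{pmatrix}.$$ (Homomorphisms are applied to matrices entrywise.)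
   Formalization: Morphisms from Γ′ to Γ‴ extending the inclusion are required to be surjective: otherwise one could add a further non-isomorphic reduced component to Γ‴ and uniqueness would fail. Fields are taken with decidable equality (automatic by excluded middle). -}

module Defs where

open import Level using (Level; _⊔_) renaming (suc to lsuc)
open import Algebra.Bundles using (CommutativeRing; RawRing)
open import Algebra.Morphism.Bundles using (RingHomomorphism)
open import Algebra.Morphism.Structures using (IsRingMonomorphism; IsRingIsomorphism)
import Algebra.Morphism.Construct.Composition as Composition
import Algebra.Morphism.RingMonomorphism as RingMonomorphism
import Algebra.Properties.Monoid.Mult as Mult
import Algebra.Properties.Monoid.Sum as Sum
import Algebra.Properties.Semiring.Exp as Exp
open import Data.Fin.Base using (Fin; zero; suc; toℕ; punchIn)
open import Data.Integer.Base as ℤ using (ℤ; +_)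
import Data.Integer.Divisibility as ℤ
import Data.Integer.Properties as ℤ
open import Data.Nat.Base as ℕ using (ℕ)
open import Data.Product.Base using (Σ; ∃; ∃-syntax; _×_; _,_; proj₁; proj₂)
import Data.Rational.Base as ℚ
import Data.Rational.Properties as ℚ
open import Data.Sum.Base using (_⊎_)
open import Function.Bundles using (_⇔_)
open import Relation.Binary.Definitions using (Decidable)
open import Relation.Binary.PropositionalEquality.Core using (_≡_)
open import Relation.Nullary using (¬_; yes; no)
open import Relation.Unary using (Pred; U; _∈_; _⊆_)

private
  variable
    a b c ℓ₁ ℓ₂ ℓ₃ ℓ : Level

------------------------------------------------------------------------
-- Commutative rings

module RingOps (R : CommutativeRing a ℓ₁) where
  open CommutativeRing R public hiding (zero)
  open Exp semiring public using (_^_)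
  open Sum +-monoid public using (sum)
  open Mult +-monoid public using () renaming (_×_ to infixr 8 _·_)

  Matrix : ℕ → ℕ → Set a
  Matrix m n = Fin m → Fin n → Carrier

  infixl 7 _⊗_
  _⊗_ : ∀ {l m n} → Matrix l m → Matrix m n → Matrix l n
  (A ⊗ B) i k = sum (λ j → A i j * B j k)

  matrix₂ : (w x y z : Carrier) → Matrix 2 2
  matrix₂ w x y z zero       zero       = w
  matrix₂ w x y z zero       (suc zero) = x
  matrix₂ w x y z (suc zero) zero       = y
  matrix₂ w x y z (suc zero) (suc zero) = z

  det : ∀ {n} → Matrix n n → Carrier
  det {ℕ.zero}  A = 1#
  det {ℕ.suc n} A = sum (λ j →
    (- 1#) ^ toℕ j * A zero j * det (λ k l → A (suc k) (punchIn j l)))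

-- The library's RingHomomorphism, with the rings themselves as parameters so
-- that they can be inferred.
record Hom (R : CommutativeRing a ℓ₁) (S : CommutativeRing b ℓ₂) : Set (a ⊔ b ⊔ ℓ₁ ⊔ ℓ₂) where
  private
    module R = CommutativeRing R
    module S = CommutativeRing S
  field
    ringHomomorphism : RingHomomorphism R.rawRing S.rawRing
  open RingHomomorphism ringHomomorphism public

open Hom using (⟦_⟧) public

infixr 9 _∘ₕ_
_∘ₕ_ : {R : CommutativeRing a ℓ₁} {S : CommutativeRing b ℓ₂} {T : CommutativeRing c ℓ₃} →
       Hom S T → Hom R S → Hom R T
_∘ₕ_ {R = R} {S} {T} g f = record
  { ringHomomorphism = Composition.ringHomomorphism
      {M₁ = CommutativeRing.ring R} {CommutativeRing.ring S} {CommutativeRing.ring T}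
      (Hom.ringHomomorphism f) (Hom.ringHomomorphism g)
  }

-- S is a finitely generated R-module via f.
IsFinite : {R : CommutativeRing a ℓ₁} {S : CommutativeRing b ℓ₂} → Hom R S → Set (a ⊔ b ⊔ ℓ₂)
IsFinite {R = R} {S} f =
  ∃[ n ] Σ (Fin n → Carrier) λ g → ∀ x → Σ (Fin n → R.Carrier) λ r →
    x ≈ sum (λ i → ⟦ f ⟧ (r i) * g i)
  where
  module R = CommutativeRing R
  open RingOps S

-- P is a prime ideal of the subring A of R; being closed under
-- multiplication by -1 ∈ A, P is closed under negation.
record IsPrimeIdeal (R : CommutativeRing a ℓ₁) (A : Pred (CommutativeRing.Carrier R) ℓ₂)
                    (P : Pred (CommutativeRing.Carrier R) ℓ) : Set (a ⊔ ℓ₁ ⊔ ℓ₂ ⊔ ℓ) where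
  open CommutativeRing R
  field
    ⊆-ring   : P ⊆ A
    resp     : ∀ {x y} → x ≈ y → x ∈ P → y ∈ P
    0∈       : 0# ∈ P
    +-closed : ∀ {x y} → x ∈ P → y ∈ P → x + y ∈ P
    absorbs  : ∀ {x y} → x ∈ A → y ∈ P → x * y ∈ P
    1∉       : ¬ 1# ∈ P
    prime    : ∀ {x y} → x ∈ A → y ∈ A → x * y ∈ P → x ∈ P ⊎ y ∈ P

-- Surjectivity of Spec S → Spec R on points, i.e. on prime ideals.
SpecSurjective : {R S : CommutativeRing ℓ ℓ} → Hom R S → Set (lsuc ℓ)
SpecSurjective {ℓ} {R} {S} f =
  (𝔮 : Pred (CommutativeRing.Carrier R) ℓ) → IsPrimeIdeal R U 𝔮 →
  Σ (Pred (CommutativeRing.Carrier S) ℓ) λ 𝔭 →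
    IsPrimeIdeal S U 𝔭 × (∀ x → x ∈ 𝔮 ⇔ ⟦ f ⟧ x ∈ 𝔭)

------------------------------------------------------------------------
-- Fields

-- Discrete fields.  Under excluded middle equality is always decidable, so
-- classically these are exactly the fields.
record Field (ℓ : Level) : Set (lsuc ℓ) where
  field
    commutativeRing : CommutativeRing ℓ ℓ
  open RingOps commutativeRing public
  field
    _≟_      : Decidable _≈_
    1≉0      : ¬ 1# ≈ 0#
    inverses : ∀ x → ¬ x ≈ 0# → ∃[ y ] x * y ≈ 1#

  -- The value at 0# is junk; inverses below are only taken of nonzero elements.
  infix 9 _⁻¹
  _⁻¹ : Carrier → Carrier
  x ⁻¹ with x ≟ 0#
  ... | yes _  = 0#
  ... | no x≉0 = proj₁ (inverses x x≉0)

  infixl 7 _/_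
  _/_ : Carrier → Carrier → Carrier
  x / y = x * y ⁻¹

⌊_⌋ : Field ℓ → CommutativeRing ℓ ℓ
⌊ K ⌋ = Field.commutativeRing K

module _ (K : Field ℓ) where
  open Field K

  -- The subfield of K generated by S.
  data Generated (S : Pred Carrier ℓ) : Pred Carrier ℓ where
    gen  : ∀ {x} → x ∈ S → x ∈ Generated S
    resp : ∀ {x y} → x ≈ y → x ∈ Generated S → y ∈ Generated S
    0∈   : 0# ∈ Generated S
    1∈   : 1# ∈ Generated S
    +∈   : ∀ {x y} → x ∈ Generated S → y ∈ Generated S → x + y ∈ Generated S
    *∈   : ∀ {x y} → x ∈ Generated S → y ∈ Generated S → x * y ∈ Generated S
    -∈   : ∀ {x} → x ∈ Generated S → - x ∈ Generated S
    ⁻¹∈  : ∀ {x y} → x ∈ Generated S → x * y ≈ 1# → y ∈ Generated S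

  module _ (S : Pred Carrier ℓ) where

    private
      rawSubfield : RawRing ℓ ℓ
      rawSubfield = record
        { Carrier = ∃ (Generated S)
        ; _≈_     = λ x y → proj₁ x ≈ proj₁ y
        ; _+_     = λ (x , p) (y , q) → x + y , +∈ p q
        ; _*_     = λ (x , p) (y , q) → x * y , *∈ p q
        ; -_      = λ (x , p) → - x , -∈ p
        ; 0#      = 0# , 0∈
        ; 1#      = 1# , 1∈
        }

      proj₁-isMonomorphism : IsRingMonomorphism rawSubfield rawRing proj₁
      proj₁-isMonomorphism = record
        { isRingHomomorphism = record
          { isSemiringHomomorphism = record
            { isNearSemiringHomomorphism = record
              { +-isMonoidHomomorphism = record
                { isMagmaHomomorphism = record
                  { isRelHomomorphism = record { cong = λ p → p }
                  ; homo              = λ _ _ → refl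
                  }
                ; ε-homo = refl
                }
              ; *-homo = λ _ _ → refl
              }
            ; 1#-homo = refl
            }
          ; -‿homo = λ _ → refl
          }
        ; injective = λ p → p
        }

    subfield : Field ℓ
    subfield = record
      { commutativeRing = record
        { isCommutativeRing =
            RingMonomorphism.isCommutativeRing proj₁-isMonomorphism isCommutativeRing }
      ; _≟_      = λ x y → proj₁ x ≟ proj₁ y
      ; 1≉0      = 1≉0
      ; inverses = λ (x , p) x≉0 → let (y , xy≈1) = inverses x x≉0 in (y , ⁻¹∈ p xy≈1) , xy≈1
      }

    inclusion : Hom ⌊ subfield ⌋ ⌊ K ⌋
    inclusion = record
      { ringHomomorphism = record
        { isRingHomomorphism = IsRingMonomorphism.isRingHomomorphism proj₁-isMonomorphism } }

------------------------------------------------------------------------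
-- Number fields

record NumberField (ℓ : Level) : Set (lsuc ℓ) where
  field
    field′ : Field ℓ
    ι      : Hom ℚ.+-*-commutativeRing ⌊ field′ ⌋
    finite : IsFinite ι

  open Field field′ public

  fromℤ : ℤ → Carrier
  fromℤ n = ⟦ ι ⟧ (n ℚ./ 1)

  -- Root of a monic polynomial with integer coefficients.
  Integral : Pred Carrier ℓ
  Integral x = ∃[ n ] Σ (Fin n → ℤ) λ r → x ^ n + sum (λ i → fromℤ (r i) * x ^ toℕ i) ≈ 0#

  -- The ring 𝒪_F[1/M], as a subset of F.
  𝒪[1/_] : ℤ → Pred Carrier ℓ
  𝒪[1/ M ] x = ∃[ k ] Integral (fromℤ M ^ k * x)

  IsUnitOf : Pred Carrier ℓ → Pred Carrier ℓ
  IsUnitOf A x = x ∈ A × ∃[ y ] y ∈ A × x * y ≈ 1#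

  record IsIntegralBasis {n} (ω : Fin n → Carrier) : Set ℓ where
    field
      integral    : ∀ i → Integral (ω i)
      spanning    : ∀ x → Integral x → Σ (Fin n → ℤ) λ r → x ≈ sum (λ i → fromℤ (r i) * ω i)
      independent : ∀ (r : Fin n → ℤ) → sum (λ i → fromℤ (r i) * ω i) ≈ 0# → ∀ i → r i ≡ + 0

  private module Z = RingOps ℤ.+-*-commutativeRing

  -- t is the trace of multiplication by x, computed on a ℤ-basis ω of 𝒪_F.
  IsTrace : ∀ {n} → (Fin n → Carrier) → Carrier → ℤ → Set ℓ
  IsTrace {n} ω x t = Σ (Z.Matrix n n) λ m →
    (∀ k → x * ω k ≈ sum (λ l → fromℤ (m k l) * ω l)) × t ≡ Z.sum (λ k → m k k)

  IsDiscriminant : ℤ → Set ℓ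
  IsDiscriminant D = ∃[ n ] Σ (Fin n → Carrier) λ ω → Σ (Z.Matrix n n) λ T →
    IsIntegralBasis ω × (∀ i j → IsTrace ω (ω i * ω j) (T i j)) × D ≡ Z.det T

  record Gal : Set ℓ where
    field
      hom           : Hom commutativeRing commutativeRing
      isIsomorphism : IsRingIsomorphism rawRing rawRing ⟦ hom ⟧
      fixesℚ        : ∀ q → ⟦ hom ⟧ (⟦ ι ⟧ q) ≈ ⟦ ι ⟧ q

  infixr 9 _⟨$⟩_
  _⟨$⟩_ : Gal → Carrier → Carrier
  σ ⟨$⟩ x = ⟦ Gal.hom σ ⟧ x

  -- The fixed field of Gal(F/ℚ) is ℚ.
  IsGalois : Set ℓ
  IsGalois = ∀ x → (∀ σ → σ ⟨$⟩ x ≈ x) → ∃[ q ] x ≈ ⟦ ι ⟧ q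

  record IsPrimeAbove (p : ℕ) (A : Pred Carrier ℓ) (𝔓 : Pred Carrier ℓ) : Set ℓ where
    field
      isPrimeIdeal : IsPrimeIdeal commutativeRing A 𝔓
      liesAbove    : ∀ n → fromℤ n ∈ 𝔓 ⇔ (+ p) ℤ.∣ n

  IsFrobenius : ℕ → (A 𝔓 : Pred Carrier ℓ) → Gal → Set ℓ
  IsFrobenius p A 𝔓 σ = ∀ x → x ∈ A → σ ⟨$⟩ x - x ^ p ∈ 𝔓

------------------------------------------------------------------------
-- Correspondences

-- A correspondence on Spec E whose total space Y = Spec 𝒪Y is affine.
-- Affine schemes and their morphisms are given by commutative rings and
-- ring homomorphisms in the opposite direction.
record Correspondence (E : Field ℓ) : Set (lsuc ℓ) where
  constructor correspondence
  field
    𝒪Y  : CommutativeRing ℓ ℓ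
    π φ : Hom ⌊ E ⌋ 𝒪Y

-- (Y, π, φ) ↦ (Y, u ∘ π, u ∘ φ) for u : Spec E → Spec E₀.
pushforward : {E₀ E : Field ℓ} → Hom ⌊ E₀ ⌋ ⌊ E ⌋ →
              Correspondence E → Correspondence E₀
pushforward u Γ = correspondence 𝒪Y (π ∘ₕ u) (φ ∘ₕ u)
  where open Correspondence Γ

-- Morphisms v : Y′ → Y of correspondences, given by v♯ : 𝒪Y → 𝒪Y′.
infix 4 _⟶_
record _⟶_ {E : Field ℓ} (Γ′ Γ : Correspondence E) : Set ℓ where
  private
    module Γ′ = Correspondence Γ′
    module Γ  = Correspondence Γ
  open CommutativeRing Γ′.𝒪Y using (_≈_)
  field
    v♯         : Hom Γ.𝒪Y Γ′.𝒪Y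
    commutes-π : ∀ x → ⟦ v♯ ⟧ (⟦ Γ.π ⟧ x) ≈ ⟦ Γ′.π ⟧ x
    commutes-φ : ∀ x → ⟦ v♯ ⟧ (⟦ Γ.φ ⟧ x) ≈ ⟦ Γ′.φ ⟧ x

-- Surjective morphisms; between objects of 𝒞₀(E), these are the morphisms
-- of 𝒞₀(E).
infix 4 _↠_
record _↠_ {E : Field ℓ} (Γ′ Γ : Correspondence E) : Set (lsuc ℓ) where
  field
    morphism   : Γ′ ⟶ Γ
  open _⟶_ morphism public
  field
    surjective : SpecSurjective v♯

open _↠_ public using (v♯)

-- Γ is an object of 𝒞₀(E).
record 𝒞₀ {E : Field ℓ} (Γ : Correspondence E) : Set (lsuc ℓ) where
  open Correspondence Γ
  private module Y = CommutativeRing 𝒪Y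
  field
    size   : ℕ
    factor : Fin size → Field ℓ
    proj   : ∀ i → Hom 𝒪Y ⌊ factor i ⌋

  private module factor i = Field (factor i)

  field
    -- The map 𝒪Y → ∏ᵢ factor i is an isomorphism.
    proj-injective  : ∀ x y → (∀ i → factor._≈_ i (⟦ proj i ⟧ x) (⟦ proj i ⟧ y)) → x Y.≈ y
    proj-surjective : ∀ (f : ∀ i → factor.Carrier i) →
                      ∃[ x ] ∀ i → factor._≈_ i (⟦ proj i ⟧ x) (f i)
    π-finite : ∀ i → IsFinite (proj i ∘ₕ π)
    φ-finite : IsFinite φ

module _ {E : Field ℓ} {Γ Γ′ : Correspondence E} where
  private
    module Γ  = CommutativeRing (Correspondence.𝒪Y Γ)
    module Γ′ = CommutativeRing (Correspondence.𝒪Y Γ′)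

  IsIso : Γ ↠ Γ′ → Set (lsuc ℓ)
  IsIso v = Σ (Γ′ ↠ Γ) λ w →
    (∀ x → ⟦ v♯ v ⟧ (⟦ v♯ w ⟧ x) Γ.≈ x) × (∀ y → ⟦ v♯ w ⟧ (⟦ v♯ v ⟧ y) Γ′.≈ y)

record IsCategoricallyReduced {E : Field ℓ} (Γ : Correspondence E) : Set (lsuc ℓ) where
  field
    object  : 𝒞₀ Γ
    reduced : ∀ Γ′ → 𝒞₀ Γ′ → (v : Γ ↠ Γ′) → IsIso v

-- Morphisms Γ′ → Γ extending u : Spec E → Spec E₀.  They are required to
-- be surjective, as in 𝒞₀: otherwise any further component could be added
-- to the target.
_↠[_]_ : {E₀ E : Field ℓ} → Correspondence E → Hom ⌊ E₀ ⌋ ⌊ E ⌋ →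
         Correspondence E₀ → Set (lsuc ℓ)
Γ′ ↠[ u ] Γ = pushforward u Γ′ ↠ Γ

------------------------------------------------------------------------
-- The fields F(α, β) ⊃ F(α / β)

-- A model of E′ = F(α, β): generated by α, β that are algebraically
-- independent over F.
record RationalFunctionField (F : Field ℓ) : Set (lsuc ℓ) where
  private module F = Field F
  field
    E′  : Field ℓ
    κ   : Hom ⌊ F ⌋ ⌊ E′ ⌋
    α β : Field.Carrier E′

  open Field E′

  field
    independent : ∀ m n (c : Fin m → Fin n → F.Carrier) →
      sum (λ i → sum (λ j → ⟦ κ ⟧ (c i j) * (α ^ toℕ i * β ^ toℕ j))) ≈ 0# →
      ∀ i j → c i j F.≈ F.0#
    generated : ∀ x → Generated E′ (λ y → (∃[ r ] y ≈ ⟦ κ ⟧ r) ⊎ y ≈ α ⊎ y ≈ β) x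

  t : Carrier
  t = α / β

  F∪t : Pred Carrier ℓ
  F∪t y = (∃[ r ] y ≈ ⟦ κ ⟧ r) ⊎ y ≈ t

  E‴ : Field ℓ
  E‴ = subfield E′ F∪t

  E‴⊂E′ : Hom ⌊ E‴ ⌋ ⌊ E′ ⌋
  E‴⊂E′ = inclusion E′ F∪t

------------------------------------------------------------------------
-- The correspondences Γ′ₚ₁, Γ′ₚ₂ on Spec E′

twist : (K : Field ℓ) (let open Field K) → (u v : Carrier) → Fin 2 → Matrix 2 2
twist K u v zero       = matrix₂ u v (- v) u  where open Field K
twist K u v (suc zero) = matrix₂ u (- v) v u  where open Field K

module _ (F : NumberField ℓ) (p : ℕ) (φₚ : NumberField.Gal F) (d : NumberField.Carrier F)
         (R : RationalFunctionField (NumberField.field′ F)) where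
  private module F = NumberField F
  open RationalFunctionField R using (E′; κ; α; β)
  private module E = Field E′

  private
    module θ where
      open Field E′
      φ[d] : F.Carrier
      φ[d] = φₚ F.⟨$⟩ d

      θₚ : Carrier
      θₚ = (⟦ κ ⟧ d ^ p * (α ^ 2 + β ^ 2) ^ p)
           / (⟦ κ ⟧ φ[d] * (α ^ (2 ℕ.* p) + β ^ (2 ℕ.* p)))

  open θ public using (θₚ)

  record LeviCivita : Set (lsuc ℓ) where
    field
      L′  : Field ℓ
      π′  : Hom ⌊ E′ ⌋ ⌊ L′ ⌋
      v   : Field.Carrier L′

    open Field L′

    u : Carrier
    u = 1# + v

    αᵖ : Carrier
    αᵖ = ⟦ π′ ⟧ α ^ p

    βᵖ : Carrier
    βᵖ = ⟦ π′ ⟧ β ^ p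

    field
      v-root    : 2 · v ^ 2 + 2 · v + 1# - ⟦ π′ ⟧ θₚ ≈ 0#
      generated : ∀ x → Generated L′ (λ y → (∃[ e ] y ≈ ⟦ π′ ⟧ e) ⊎ y ≈ v) x
      φ′        : Fin 2 → Hom ⌊ E′ ⌋ ⌊ L′ ⌋
      φ′-on-F   : ∀ i r → ⟦ φ′ i ⟧ (⟦ κ ⟧ r) ≈ ⟦ π′ ⟧ (⟦ κ ⟧ (φₚ F.⟨$⟩ r))
      φ′-on-αβ  : ∀ i j k →
        ⟦ φ′ i ⟧ (E.matrix₂ α β (E.- β) α j k)
          ≈ (matrix₂ αᵖ βᵖ (- βᵖ) αᵖ ⊗ twist L′ u v i) j k

    Γ′ₚ : Fin 2 → Correspondence E′
    Γ′ₚ i = correspondence ⌊ L′ ⌋ π′ (φ′ i)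

{-# OPTIONS --safe #-}

-- Let C ⊂ L′ be generated by π′(E‴) and v.  With s = φ′ᵢ(t), T = tᵖ and εᵢ = ±1, the formula
-- for φ′ᵢ makes s a fractional linear function of v over F(T), which can be inverted:
--   v D = εᵢ (T - s),  D = s T + 1 - εᵢ (T - s) ≠ 0.
-- Hence C contains φ′ᵢ(E‴) and is the compositum of π′(E‴) and φ′ᵢ(E‴) for both i.
--
-- A surjective morphism from Spec L′ to an object Γ of 𝒞₀(E‴) identifies 𝒪(Γ) with a
-- subfield of L′ which contains the compositum C, so it can be continued to Spec C.  This
-- shows that Spec C is categorically reduced, and that every categorically reduced Γ
-- under Spec L′ is isomorphic to Spec C.
--
-- C is finite over π′(E‴) because v is quadratic.  Substituting v into 2v² + 2v + 1 = θₚ gives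
--   φₚ(d) (s² + 1) (T² + 1)² = dᵖ (t² + 1)ᵖ D²,
-- a polynomial relation for t over φ′ᵢ(E‴) = F(s), so that C is also finite over φ′ᵢ(E‴).

module Submission where

open import Defs
open import Level using (Level)
open import Algebra.Bundles using (CommutativeRing)
import Algebra.Morphism.Construct.Identity as Identity
open import Algebra.Morphism.Structures using (IsRingIsomorphism)
import Algebra.Properties.AbelianGroup as AbelianGroupProperties
import Algebra.Properties.CommutativeSemiring.Exp as ExpProperties
import Algebra.Properties.Ring as RingProperties
import Algebra.Properties.Semiring.Mult.TCOptimised as Mult
import Algebra.Properties.Semiring.Sum as SemiringSum
import Algebra.Solver.Ring as RingSolver
open import Algebra.Solver.Ring.AlmostCommutativeRing
  using (fromCommutativeRing; _-Raw-AlmostCommutative⟶_; Induced-equivalence)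
open import Data.Fin.Base using (Fin; zero; suc; toℕ; fromℕ; opposite)
import Data.Fin.Properties as Fin
open import Data.Integer.Base as ℤ using (ℤ; +_; -[1+_])
open import Data.Integer.Divisibility using (_∣_)
import Data.Integer.Properties as ℤ
open import Data.Maybe.Base using (just; nothing)
open import Data.Nat.Base as ℕ using (ℕ; _<_; z<s)
open import Data.Nat.Induction using (<-wellFounded)
open import Data.Nat.Primality using (Prime; ¬prime[0])
import Data.Nat.Properties as ℕ
open import Data.Product.Base using (Σ; ∃; ∃-syntax; _×_; _,_; proj₁; proj₂)
import Data.Rational.Base as ℚ
import Data.Sign.Base as Sign
open import Data.Sum.Base using (_⊎_; inj₁; inj₂)
open import Function.Bundles using (mk⇔; Equivalence)
open import Induction.WellFounded using (Acc; acc)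
open import Relation.Binary.Definitions using (WeaklyDecidable)
open import Relation.Binary.PropositionalEquality.Core as ≡ using (_≡_; _≢_)
import Relation.Binary.Reasoning.Setoid as SetoidReasoning
open import Relation.Nullary using (¬_; yes; no; contradiction)
open import Relation.Nullary.Decidable using (decidable-stable)
open import Relation.Unary using (Pred; U; _∈_; _⊆_)

private
  variable
    a ℓ₁ ℓ : Level

-- Ring identities with integer coefficients

module IntegerSolver (R : CommutativeRing a ℓ₁) where
  open CommutativeRing R
  open RingProperties ring using (-‿distribˡ-*; -‿distribʳ-*; -0#≈0#; -‿involutive)
  open AbelianGroupProperties +-abelianGroup using (⁻¹-∙-comm)
  open Mult semiring using (×-homo-+; ×1-homo-*; 1+×) renaming (_×_ to _·_)
  open SetoidReasoning setoid

  private
    value : ℤ → Carrier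
    value (+ n)    = n · 1#
    value -[1+ n ] = - (ℕ.suc n · 1#)

    neg-homo : ∀ i → value (ℤ.- i) ≈ - value i
    neg-homo (+ ℕ.zero)  = sym -0#≈0#
    neg-homo (+ ℕ.suc n) = refl
    neg-homo -[1+ n ]    = sym (-‿involutive _)

    -- One step of `⊖-homo`, whose recursion removes a successor from both arguments.
    cancel-1 : ∀ x y → x - y ≈ (1# + x) - (1# + y)
    cancel-1 x y = begin
      x - y                      ≈⟨ +-congʳ (+-identityˡ x) ⟨
      0# + x - y                 ≈⟨ +-congʳ (+-congʳ (-‿inverseʳ 1#)) ⟨
      1# - 1# + x - y            ≈⟨ +-congʳ (+-assoc _ _ _) ⟩
      1# + (- 1# + x) - y        ≈⟨ +-congʳ (+-congˡ (+-comm _ _)) ⟩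
      1# + (x - 1#) - y          ≈⟨ +-congʳ (+-assoc _ _ _) ⟨
      1# + x - 1# - y            ≈⟨ +-assoc _ _ _ ⟩
      1# + x + (- 1# - y)        ≈⟨ +-congˡ (⁻¹-∙-comm 1# y) ⟩
      (1# + x) - (1# + y)        ∎

    ⊖-homo : ∀ m n → value (m ℤ.⊖ n) ≈ m · 1# - n · 1#
    ⊖-homo m         ℕ.zero    = trans (sym (+-identityʳ _)) (+-congˡ (sym -0#≈0#))
    ⊖-homo ℕ.zero    (ℕ.suc n) = sym (+-identityˡ _)
    ⊖-homo (ℕ.suc m) (ℕ.suc n) = begin
      value (ℕ.suc m ℤ.⊖ ℕ.suc n)          ≡⟨ ≡.cong value (ℤ.[1+m]⊖[1+n]≡m⊖n m n) ⟩
      value (m ℤ.⊖ n)                      ≈⟨ ⊖-homo m n ⟩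
      m · 1# - n · 1#                      ≈⟨ cancel-1 _ _ ⟩
      (1# + m · 1#) - (1# + n · 1#)        ≈⟨ +-cong (1+× m 1#) (-‿cong (1+× n 1#)) ⟨
      ℕ.suc m · 1# - ℕ.suc n · 1#          ∎

    add-homo : ∀ i j → value (i ℤ.+ j) ≈ value i + value j
    add-homo (+ m)    (+ n)    = ×-homo-+ 1# m n
    add-homo (+ m)    -[1+ n ] = ⊖-homo m (ℕ.suc n)
    add-homo -[1+ m ] (+ n)    = trans (⊖-homo n (ℕ.suc m)) (+-comm _ _)
    add-homo -[1+ m ] -[1+ n ] = begin
      - (ℕ.suc (ℕ.suc (m ℕ.+ n)) · 1#)        ≡⟨ ≡.cong (λ k → - (k · 1#)) (ℕ.+-suc (ℕ.suc m) n) ⟨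
      - ((ℕ.suc m ℕ.+ ℕ.suc n) · 1#)          ≈⟨ -‿cong (×-homo-+ 1# (ℕ.suc m) (ℕ.suc n)) ⟩
      - (ℕ.suc m · 1# + ℕ.suc n · 1#)         ≈⟨ ⁻¹-∙-comm _ _ ⟨
      - (ℕ.suc m · 1#) - ℕ.suc n · 1#         ∎

    ◃-homo : ∀ n → value (Sign.- ℤ.◃ n) ≈ - (n · 1#)
    ◃-homo n = trans (reflexive (≡.cong value (ℤ.-◃n≡-n n))) (neg-homo (+ n))

    mul-homo : ∀ i j → value (i ℤ.* j) ≈ value i * value j
    mul-homo (+ m) (+ n) =
      trans (reflexive (≡.cong value (ℤ.+◃n≡+n (m ℕ.* n)))) (×1-homo-* m n)
    mul-homo (+ m) -[1+ n ] =
      trans (◃-homo (m ℕ.* ℕ.suc n)) (trans (-‿cong (×1-homo-* m (ℕ.suc n))) (-‿distribʳ-* _ _))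
    mul-homo -[1+ m ] (+ n) =
      trans (◃-homo (ℕ.suc m ℕ.* n)) (trans (-‿cong (×1-homo-* (ℕ.suc m) n)) (-‿distribˡ-* _ _))
    mul-homo -[1+ m ] -[1+ n ] = begin
      (ℕ.suc m ℕ.* ℕ.suc n) · 1#                ≈⟨ ×1-homo-* (ℕ.suc m) (ℕ.suc n) ⟩
      ℕ.suc m · 1# * ℕ.suc n · 1#               ≈⟨ -‿involutive _ ⟨
      - - (ℕ.suc m · 1# * ℕ.suc n · 1#)         ≈⟨ -‿cong (-‿distribˡ-* _ _) ⟩
      - (- (ℕ.suc m · 1#) * ℕ.suc n · 1#)       ≈⟨ -‿distribʳ-* _ _ ⟩
      - (ℕ.suc m · 1#) * - (ℕ.suc n · 1#)       ∎

    homomorphism : ℤ.+-*-rawRing -Raw-AlmostCommutative⟶ fromCommutativeRing R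
    homomorphism = record
      { ⟦_⟧    = value
      ; +-homo = add-homo
      ; *-homo = mul-homo
      ; -‿homo = neg-homo
      ; 0-homo = refl
      ; 1-homo = refl
      }

    -- Equal integers have equal values. Distinct integers may also have equal values in positive
    -- characteristic, so for them no answer is given.
    value≟ : WeaklyDecidable (Induced-equivalence homomorphism)
    value≟ i j with i ℤ.≟ j
    ... | yes i≡j = just (reflexive (≡.cong value i≡j))
    ... | no  _   = nothing

  open RingSolver ℤ.+-*-rawRing (fromCommutativeRing R) homomorphism value≟ public
    using (solve; _:=_; _:+_; _:*_; _:-_; :-_; con)

-- Homomorphisms and spectra of fields

idₕ : (R : CommutativeRing a ℓ₁) → Hom R R
idₕ R = record { ringHomomorphism = record
  { isRingHomomorphism = Identity.isRingHomomorphism rawRing refl } }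
  where open CommutativeRing R

module FieldProperties (K : Field ℓ) where
  open Field K
  open SetoidReasoning setoid
  open AbelianGroupProperties +-abelianGroup public
    using () renaming (x∙y⁻¹≈ε⇒x≈y to x-y≈0⇒x≈y)

  x≈y⇒x-y≈0 : ∀ {x y} → x ≈ y → x - y ≈ 0#
  x≈y⇒x-y≈0 x≈y = trans (+-congʳ x≈y) (-‿inverseʳ _)

  -- Reduces an identity modulo a relation `z ≈ 0#` to a pure ring identity for the solver, with `a`
  -- as the explicit cofactor of the relation.
  x≈y+multiple : ∀ {x y z} a → z ≈ 0# → x ≈ y + a * z → x ≈ y
  x≈y+multiple a z≈0 x≈ =
    trans x≈ (trans (+-congˡ (trans (*-congˡ z≈0) (zeroʳ a))) (+-identityʳ _))

  x*y≉0⇒x≉0 : ∀ {x y} → ¬ x * y ≈ 0# → ¬ x ≈ 0#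
  x*y≉0⇒x≉0 xy≉0 x≈0 = xy≉0 (trans (*-congʳ x≈0) (zeroˡ _))

  x*y≈1⇒x≉0 : ∀ {x y} → x * y ≈ 1# → ¬ x ≈ 0#
  x*y≈1⇒x≉0 xy≈1 x≈0 = 1≉0 (trans (sym xy≈1) (trans (*-congʳ x≈0) (zeroˡ _)))

  *-cancelˡ : ∀ {x y z} → ¬ x ≈ 0# → x * y ≈ x * z → y ≈ z
  *-cancelˡ {x} {y} {z} x≉0 xy≈xz = let (x′ , xx′≈1) = inverses x x≉0 in begin
    y             ≈⟨ *-identityˡ y ⟨
    1# * y        ≈⟨ *-congʳ (trans (*-comm x′ x) xx′≈1) ⟨
    x′ * x * y    ≈⟨ *-assoc _ _ _ ⟩
    x′ * (x * y)  ≈⟨ *-congˡ xy≈xz ⟩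
    x′ * (x * z)  ≈⟨ *-assoc _ _ _ ⟨
    x′ * x * z    ≈⟨ *-congʳ (trans (*-comm x′ x) xx′≈1) ⟩
    1# * z        ≈⟨ *-identityˡ z ⟩
    z             ∎

  *-cancelˡ-0 : ∀ {x y} → ¬ x ≈ 0# → x * y ≈ 0# → y ≈ 0#
  *-cancelˡ-0 x≉0 xy≈0 = *-cancelˡ x≉0 (trans xy≈0 (sym (zeroʳ _)))

  *-≉0 : ∀ {x y} → ¬ x ≈ 0# → ¬ y ≈ 0# → ¬ x * y ≈ 0#
  *-≉0 x≉0 y≉0 xy≈0 = y≉0 (*-cancelˡ-0 x≉0 xy≈0)

  ^-≉0 : ∀ {x} → ¬ x ≈ 0# → ∀ n → ¬ x ^ n ≈ 0#
  ^-≉0 x≉0 ℕ.zero    = 1≉0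
  ^-≉0 x≉0 (ℕ.suc n) = *-≉0 x≉0 (^-≉0 x≉0 n)

  x*y≈0⇒x≈0∨y≈0 : ∀ x y → x * y ≈ 0# → x ≈ 0# ⊎ y ≈ 0#
  x*y≈0⇒x≈0∨y≈0 x y xy≈0 with x ≟ 0#
  ... | yes x≈0 = inj₁ x≈0
  ... | no  x≉0 = inj₂ (*-cancelˡ-0 x≉0 xy≈0)

  *-inverseʳ : ∀ {x} → ¬ x ≈ 0# → x * x ⁻¹ ≈ 1#
  *-inverseʳ {x} x≉0 with x ≟ 0#
  ... | yes x≈0  = contradiction x≈0 x≉0
  ... | no  x≉0′ = proj₂ (inverses x x≉0′)

  x/y*y≈x : ∀ x {y} → ¬ y ≈ 0# → (x / y) * y ≈ x
  x/y*y≈x x {y} y≉0 = begin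
    x * y ⁻¹ * y    ≈⟨ *-assoc _ _ _ ⟩
    x * (y ⁻¹ * y)  ≈⟨ *-congˡ (trans (*-comm _ _) (*-inverseʳ y≉0)) ⟩
    x * 1#          ≈⟨ *-identityʳ x ⟩
    x               ∎

module HomProperties {R : CommutativeRing a ℓ₁} {S : CommutativeRing a ℓ₁} (f : Hom R S) where
  private
    module R = RingOps R
    module S = RingOps S
  open Hom f using (⟦⟧-cong; +-homo; *-homo; -‿homo; 1#-homo)

  minus-homo : ∀ x y → ⟦ f ⟧ (x R.- y) S.≈ ⟦ f ⟧ x S.- ⟦ f ⟧ y
  minus-homo x y = S.trans (+-homo x _) (S.+-congˡ (-‿homo y))

  ^-homo : ∀ x n → ⟦ f ⟧ (x R.^ n) S.≈ ⟦ f ⟧ x S.^ n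
  ^-homo x ℕ.zero    = 1#-homo
  ^-homo x (ℕ.suc n) = S.trans (*-homo x _) (S.*-congˡ (^-homo x n))

  sum-homo : ∀ {n} (x : Fin n → R.Carrier) → ⟦ f ⟧ (R.sum x) S.≈ S.sum (λ i → ⟦ f ⟧ (x i))
  sum-homo {ℕ.zero}  x = Hom.0#-homo f
  sum-homo {ℕ.suc n} x = S.trans (+-homo _ _) (S.+-congˡ (sum-homo (λ i → x (suc i))))

module FieldHom (K : Field ℓ) {R : CommutativeRing ℓ ℓ} (f : Hom ⌊ K ⌋ R) where
  private
    module K = Field K
    module R = CommutativeRing R

  inverse-homo : ∀ {x y} → x K.* y K.≈ K.1# → ⟦ f ⟧ x R.* ⟦ f ⟧ y R.≈ R.1#
  inverse-homo xy≈1 =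
    R.trans (R.sym (Hom.*-homo f _ _)) (R.trans (Hom.⟦⟧-cong f xy≈1) (Hom.1#-homo f))

  -- A nonzero element of a field is a unit, and the image of a unit vanishes only in the zero ring.
  ≉0-homo : ¬ R.1# R.≈ R.0# → ∀ {x} → ¬ x K.≈ K.0# → ¬ ⟦ f ⟧ x R.≈ R.0#
  ≉0-homo 1≉0 {x} x≉0 fx≈0 = let (y , xy≈1) = K.inverses x x≉0 in
    1≉0 (R.trans (R.sym (inverse-homo xy≈1)) (R.trans (R.*-congʳ fx≈0) (R.zeroˡ _)))

module _ {R : CommutativeRing ℓ ℓ} (K : Field ℓ) (f : Hom R ⌊ K ⌋) where
  private module R = CommutativeRing R
  open Field K
  open FieldProperties K
  open Hom f

  ker-isPrimeIdeal : IsPrimeIdeal R U (λ x → Hom.⟦ f ⟧ x ≈ 0#)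
  ker-isPrimeIdeal = record
    { ⊆-ring   = _
    ; resp     = λ x≈y fx≈0 → trans (sym (⟦⟧-cong x≈y)) fx≈0
    ; 0∈       = 0#-homo
    ; +-closed = λ fx≈0 fy≈0 → trans (+-homo _ _) (trans (+-cong fx≈0 fy≈0) (+-identityˡ 0#))
    ; absorbs  = λ _ fy≈0 → trans (*-homo _ _) (trans (*-congˡ fy≈0) (zeroʳ _))
    ; 1∉       = λ f1≈0 → 1≉0 (trans (sym 1#-homo) f1≈0)
    ; prime    = λ _ _ fxy≈0 → x*y≈0⇒x≈0∨y≈0 _ _ (trans (sym (*-homo _ _)) fxy≈0)
    }

module _ (K : Field ℓ) {𝔮 : Pred (Field.Carrier K) ℓ} (isPrime : IsPrimeIdeal ⌊ K ⌋ U 𝔮) where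
  open Field K
  private module 𝔮 = IsPrimeIdeal isPrime

  -- A nonzero element of `𝔮` would be a unit and put 1 into `𝔮`.
  field-prime⇒0 : ∀ {x} → x ∈ 𝔮 → x ≈ 0#
  field-prime⇒0 {x} x∈𝔮 = decidable-stable (x ≟ 0#) λ x≉0 →
    let (y , xy≈1) = inverses x x≉0 in 𝔮.1∉ (𝔮.resp (trans (*-comm y x) xy≈1) (𝔮.absorbs _ x∈𝔮))

specSurjective-∘ : {R S T : CommutativeRing ℓ ℓ} (g : Hom S T) (f : Hom R S) →
                   SpecSurjective g → SpecSurjective f → SpecSurjective (g ∘ₕ f)
specSurjective-∘ g f g-surj f-surj 𝔯 𝔯-prime =
  let (𝔮 , 𝔮-prime , 𝔯⇔𝔮) = f-surj 𝔯 𝔯-prime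
      (𝔭 , 𝔭-prime , 𝔮⇔𝔭) = g-surj 𝔮 𝔮-prime
  in 𝔭 , 𝔭-prime , λ x → mk⇔
    (λ x∈𝔯 → Equivalence.to (𝔮⇔𝔭 _) (Equivalence.to (𝔯⇔𝔮 x) x∈𝔯))
    (λ gfx∈𝔭 → Equivalence.from (𝔯⇔𝔮 x) (Equivalence.from (𝔮⇔𝔭 _) gfx∈𝔭))

-- The prime of R over (0) is the kernel of a point R → L.
specSurjective-fromField : (K L : Field ℓ) {R : CommutativeRing ℓ ℓ} (f : Hom ⌊ K ⌋ R) →
                           Hom R ⌊ L ⌋ → SpecSurjective f
specSurjective-fromField K L {R} f g 𝔮 𝔮-prime =
  (λ y → ⟦ g ⟧ y L.≈ L.0#) , ker-isPrimeIdeal L g , λ x → mk⇔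
    (λ x∈𝔮 → L.trans (Hom.⟦⟧-cong (g ∘ₕ f) (field-prime⇒0 K 𝔮-prime x∈𝔮)) (Hom.0#-homo (g ∘ₕ f)))
    (λ gfx≈0 → IsPrimeIdeal.resp 𝔮-prime
      (K.sym (decidable-stable (x K.≟ K.0#) λ x≉0 → FieldHom.≉0-homo K (g ∘ₕ f) L.1≉0 x≉0 gfx≈0))
      (IsPrimeIdeal.0∈ 𝔮-prime))
  where
  module K = Field K
  module L = Field L

-- Surjective maps from the spectrum of a field to an object of 𝒞₀

module _ {E : Field ℓ} {Γ : Correspondence E} (object : 𝒞₀ Γ) (L : Field ℓ)
         (f : Hom (Correspondence.𝒪Y Γ) ⌊ L ⌋) (surjective : SpecSurjective f) where
  private
    open 𝒞₀ object
    module Y = CommutativeRing (Correspondence.𝒪Y Γ)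
    module L = Field L
    module factor i = Field (factor i)
    open HomProperties {R = Correspondence.𝒪Y Γ}

    -- By surjectivity the kernel of `proj i` is the preimage of a prime of `L`. Every prime
    -- contains 0, so the kernel of `f` lies in the kernel of each `proj i`.
    ker-proj : ∀ i {x} → ⟦ f ⟧ x L.≈ L.0# → factor._≈_ i (⟦ proj i ⟧ x) (factor.0# i)
    ker-proj i {x} fx≈0 =
      let (𝔭 , 𝔭-prime , ker⇔𝔭) = surjective _ (ker-isPrimeIdeal (factor i) (proj i))
      in Equivalence.from (ker⇔𝔭 x)
           (IsPrimeIdeal.resp 𝔭-prime (L.sym fx≈0) (IsPrimeIdeal.0∈ 𝔭-prime))

  specSurjective⇒injective : ∀ {x y} → ⟦ f ⟧ x L.≈ ⟦ f ⟧ y → x Y.≈ y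
  specSurjective⇒injective {x} {y} fx≈fy = proj-injective x y λ i →
    FieldProperties.x-y≈0⇒x≈y (factor i) _ _
      (factor.trans i (factor.sym i (minus-homo (proj i) x y))
        (ker-proj i (L.trans (minus-homo f x y) (FieldProperties.x≈y⇒x-y≈0 L fx≈fy))))

  -- The kernel of `proj i` is the preimage of a prime of the field `L`, that is, of zero. An
  -- element with nonzero image in `L` is therefore nonzero in every factor, and the inverses in the
  -- factors combine to an inverse in `𝒪Y`.
  specSurjective⇒image-inverse : ∀ x b → ⟦ f ⟧ x L.* b L.≈ L.1# → ∃[ y ] ⟦ f ⟧ y L.≈ b
  specSurjective⇒image-inverse x b fx*b≈1 = y ,
    FieldProperties.*-cancelˡ L fx≉0
      (L.trans (L.sym (Hom.*-homo f x y))
        (L.trans (L.trans (Hom.⟦⟧-cong f xy≈1) (Hom.1#-homo f)) (L.sym fx*b≈1)))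
    where
    fx≉0 = FieldProperties.x*y≈1⇒x≉0 L fx*b≈1

    proj≉0 : ∀ i → ¬ factor._≈_ i (⟦ proj i ⟧ x) (factor.0# i)
    proj≉0 i px≈0 =
      let (𝔭 , 𝔭-prime , ker⇔𝔭) = surjective _ (ker-isPrimeIdeal (factor i) (proj i))
      in fx≉0 (field-prime⇒0 L 𝔭-prime (Equivalence.to (ker⇔𝔭 x) px≈0))

    inverse : ∀ i → ∃[ z ] factor._≈_ i (factor._*_ i (⟦ proj i ⟧ x) z) (factor.1# i)
    inverse i = factor.inverses i (⟦ proj i ⟧ x) (proj≉0 i)

    y = proj₁ (proj-surjective (λ i → proj₁ (inverse i)))

    xy≈1 : x Y.* y Y.≈ Y.1#
    xy≈1 = proj-injective _ _ λ i →
      factor.trans i (Hom.*-homo (proj i) x y)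
        (factor.trans i (factor.*-congˡ i (proj₂ (proj-surjective _) i))
          (factor.trans i (proj₂ (inverse i)) (factor.sym i (Hom.1#-homo (proj i)))))

-- Generated subfields and homomorphisms to and from them

module _ (L : Field ℓ) where
  open Field L

  private variable S S′ : Pred Carrier ℓ

  Generated-⊆ : S ⊆ Generated L S′ → Generated L S ⊆ Generated L S′
  Generated-⊆ S⊆ (gen x∈S)     = S⊆ x∈S
  Generated-⊆ S⊆ (resp x≈y x∈) = resp x≈y (Generated-⊆ S⊆ x∈)
  Generated-⊆ S⊆ 0∈            = 0∈
  Generated-⊆ S⊆ 1∈            = 1∈
  Generated-⊆ S⊆ (+∈ x∈ y∈)    = +∈ (Generated-⊆ S⊆ x∈) (Generated-⊆ S⊆ y∈)
  Generated-⊆ S⊆ (*∈ x∈ y∈)    = *∈ (Generated-⊆ S⊆ x∈) (Generated-⊆ S⊆ y∈)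
  Generated-⊆ S⊆ (-∈ x∈)       = -∈ (Generated-⊆ S⊆ x∈)
  Generated-⊆ S⊆ (⁻¹∈ x∈ xy≈1) = ⁻¹∈ (Generated-⊆ S⊆ x∈) xy≈1

  ^∈ : ∀ {x} → x ∈ Generated L S → ∀ n → x ^ n ∈ Generated L S
  ^∈ x∈ ℕ.zero    = 1∈
  ^∈ x∈ (ℕ.suc n) = *∈ x∈ (^∈ x∈ n)

  quotient∈ : ∀ {x y z} → ¬ y ≈ 0# → y ∈ Generated L S → z ∈ Generated L S → x * y ≈ z →
              x ∈ Generated L S
  quotient∈ {x = x} {y} {z} y≉0 y∈ z∈ xy≈z =
    resp z/y≈x (*∈ z∈ (⁻¹∈ y∈ (*-inverseʳ y≉0)))
    where
    open FieldProperties L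
    z/y≈x : z * y ⁻¹ ≈ x
    z/y≈x = *-cancelˡ y≉0 (trans (*-comm _ _) (trans (x/y*y≈x z y≉0) (trans (sym xy≈z) (*-comm x y))))

  -- `R` is only a ring, so closure of the image under inverses enters as an assumption. With it the
  -- image is a subfield.
  Generated-⊆-image : {R : CommutativeRing ℓ ℓ} (f : Hom R ⌊ L ⌋) →
    (∀ x b → ⟦ f ⟧ x * b ≈ 1# → ∃[ y ] ⟦ f ⟧ y ≈ b) →
    (∀ {x} → x ∈ S → ∃[ y ] ⟦ f ⟧ y ≈ x) →
    ∀ {x} → x ∈ Generated L S → ∃[ y ] ⟦ f ⟧ y ≈ x
  Generated-⊆-image {S = S} {R} f image-inverse S⊆image = image
    where
    open Hom f
    open CommutativeRing R using () renaming (_+_ to _+′_; _*_ to _*′_; -_ to -′_; 0# to 0′; 1# to 1′)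
    image : ∀ {x} → x ∈ Generated L S → ∃[ y ] Hom.⟦ f ⟧ y ≈ x
    image (gen x∈S)     = S⊆image x∈S
    image (resp x≈y x∈) = let (x′ , p) = image x∈ in x′ , trans p x≈y
    image 0∈            = 0′ , 0#-homo
    image 1∈            = 1′ , 1#-homo
    image (+∈ x∈ y∈)    = let (x′ , p) = image x∈ ; (y′ , q) = image y∈ in
      x′ +′ y′ , trans (+-homo _ _) (+-cong p q)
    image (*∈ x∈ y∈)    = let (x′ , p) = image x∈ ; (y′ , q) = image y∈ in
      x′ *′ y′ , trans (*-homo _ _) (*-cong p q)
    image (-∈ x∈)       = let (x′ , p) = image x∈ in -′ x′ , trans (-‿homo _) (-‿cong p)
    image (⁻¹∈ x∈ xy≈1) = let (x′ , p) = image x∈ in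
      image-inverse x′ _ (trans (*-congʳ p) xy≈1)

  Generated-map : (K : Field ℓ) (f : Hom ⌊ K ⌋ ⌊ L ⌋) {T : Pred (Field.Carrier K) ℓ} →
    (∀ {x} → x ∈ T → ⟦ f ⟧ x ∈ Generated L S) →
    ∀ {x} → x ∈ Generated K T → ⟦ f ⟧ x ∈ Generated L S
  Generated-map {S = S} K f {T} T⊆ = image
    where
    open Hom f
    image : ∀ {x} → x ∈ Generated K T → Hom.⟦ f ⟧ x ∈ Generated L S
    image (gen x∈T)     = T⊆ x∈T
    image (resp x≈y x∈) = resp (⟦⟧-cong x≈y) (image x∈)
    image 0∈            = resp (sym 0#-homo) 0∈
    image 1∈            = resp (sym 1#-homo) 1∈
    image (+∈ x∈ y∈)    = resp (sym (+-homo _ _)) (+∈ (image x∈) (image y∈))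
    image (*∈ x∈ y∈)    = resp (sym (*-homo _ _)) (*∈ (image x∈) (image y∈))
    image (-∈ x∈)       = resp (sym (-‿homo _)) (-∈ (image x∈))
    image (⁻¹∈ x∈ xy≈1) = ⁻¹∈ (image x∈) (FieldHom.inverse-homo K f xy≈1)

  module _ (S : Pred Carrier ℓ) {R : CommutativeRing ℓ ℓ} where
    private module R = CommutativeRing R

    corestrict : (f : Hom R ⌊ L ⌋) → (∀ x → ⟦ f ⟧ x ∈ Generated L S) → Hom R ⌊ subfield L S ⌋
    corestrict f f∈ = record { ringHomomorphism = record
      { ⟦_⟧ = λ x → Hom.⟦ f ⟧ x , f∈ x
      ; isRingHomomorphism = record
        { isSemiringHomomorphism = record
          { isNearSemiringHomomorphism = record
            { +-isMonoidHomomorphism = record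
              { isMagmaHomomorphism = record
                { isRelHomomorphism = record { cong = ⟦⟧-cong }
                ; homo = +-homo
                }
              ; ε-homo = 0#-homo
              }
            ; *-homo = *-homo
            }
          ; 1#-homo = 1#-homo
          }
        ; -‿homo = -‿homo
        }
      } }
      where open Hom f

    module _ (f : Hom R ⌊ L ⌋) (injective : ∀ {x y} → ⟦ f ⟧ x ≈ ⟦ f ⟧ y → x R.≈ y)
             (image : ∀ {x} → x ∈ Generated L S → ∃[ y ] ⟦ f ⟧ y ≈ x) where
      open Hom f using (⟦⟧-cong; +-homo; *-homo; -‿homo; 0#-homo; 1#-homo)

      private
        from : ∃ (Generated L S) → R.Carrier
        from (x , x∈) = proj₁ (image x∈)

        f∘from : ∀ x → ⟦ f ⟧ (from x) ≈ proj₁ x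
        f∘from (x , x∈) = proj₂ (image x∈)

        -- The chosen preimage depends on the membership proof, but by injectivity only up to
        -- equality in `R`. All homomorphism laws of `liftToDomain` are instances of this.
        unique : ∀ x {y} → proj₁ x ≈ ⟦ f ⟧ y → from x R.≈ y
        unique x x≈fy = injective (trans (f∘from x) x≈fy)

      liftToDomain : Hom ⌊ subfield L S ⌋ R
      liftToDomain = record { ringHomomorphism = record
        { ⟦_⟧ = from
        ; isRingHomomorphism = record
          { isSemiringHomomorphism = record
            { isNearSemiringHomomorphism = record
              { +-isMonoidHomomorphism = record
                { isMagmaHomomorphism = record
                  { isRelHomomorphism = record
                    { cong = λ {x} {y} x≈y → unique x (trans x≈y (sym (f∘from y))) }
                  ; homo = λ x@(_ , x∈) y@(_ , y∈) → unique (_ , +∈ x∈ y∈)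
                      (sym (trans (+-homo _ _) (+-cong (f∘from x) (f∘from y))))
                  }
                ; ε-homo = unique (_ , 0∈) (sym 0#-homo)
                }
              ; *-homo = λ x@(_ , x∈) y@(_ , y∈) → unique (_ , *∈ x∈ y∈)
                  (sym (trans (*-homo _ _) (*-cong (f∘from x) (f∘from y))))
              }
            ; 1#-homo = unique (_ , 1∈) (sym 1#-homo)
            }
          ; -‿homo = λ x@(_ , x∈) → unique (_ , -∈ x∈) (sym (trans (-‿homo _) (-‿cong (f∘from x))))
          }
        } }

      liftToDomain-section : ∀ x → ⟦ f ⟧ (⟦ liftToDomain ⟧ x) ≈ proj₁ x
      liftToDomain-section = f∘from

-- Categorically reduced correspondences

infixr 9 _∘↠_
_∘↠_ : {E : Field ℓ} {Γ₁ Γ₂ Γ₃ : Correspondence E} → Γ₂ ↠ Γ₃ → Γ₁ ↠ Γ₂ → Γ₁ ↠ Γ₃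
_∘↠_ {Γ₁ = Γ₁} n m = record
  { morphism = record
    { v♯         = v♯ m ∘ₕ v♯ n
    ; commutes-π = λ x → trans (Hom.⟦⟧-cong (v♯ m) (n.commutes-π x)) (m.commutes-π x)
    ; commutes-φ = λ x → trans (Hom.⟦⟧-cong (v♯ m) (n.commutes-φ x)) (m.commutes-φ x)
    }
  ; surjective = specSurjective-∘ (v♯ m) (v♯ n) m.surjective n.surjective
  }
  where
  open CommutativeRing (Correspondence.𝒪Y Γ₁) using (trans)
  module m = _↠_ m
  module n = _↠_ n

∘↠-isIso : {E : Field ℓ} {Γ₁ Γ₂ Γ₃ : Correspondence E} (n : Γ₂ ↠ Γ₃) (m : Γ₁ ↠ Γ₂) →
           IsIso n → IsIso m → IsIso (n ∘↠ m)
∘↠-isIso {Γ₁ = Γ₁} {Γ₃ = Γ₃} n m (n⁻¹ , nn⁻¹ , n⁻¹n) (m⁻¹ , mm⁻¹ , m⁻¹m) =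
  m⁻¹ ∘↠ n⁻¹
  , (λ x → Y₁.trans (Hom.⟦⟧-cong (v♯ m) (nn⁻¹ (⟦ v♯ m⁻¹ ⟧ x))) (mm⁻¹ x))
  , (λ y → Y₃.trans (Hom.⟦⟧-cong (v♯ n⁻¹) (m⁻¹m (⟦ v♯ n ⟧ y))) (n⁻¹n y))
  where
  module Y₁ = CommutativeRing (Correspondence.𝒪Y Γ₁)
  module Y₃ = CommutativeRing (Correspondence.𝒪Y Γ₃)

-- The generating set `S` is a parameter, so that a single ring `subfield L S` can serve for several
-- `φ`. Once `S⊆` is assumed as well, this subfield is the compositum of the images of `π` and `φ`.
module Compositum
  (E L : Field ℓ) (π φ : Hom ⌊ E ⌋ ⌊ L ⌋) (S : Pred (Field.Carrier L) ℓ)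
  (π∈ : ∀ e → ⟦ π ⟧ e ∈ Generated L S) (φ∈ : ∀ e → ⟦ φ ⟧ e ∈ Generated L S)
  where
  open Field L

  Γ Γ̄ : Correspondence E
  Γ = correspondence ⌊ L ⌋ π φ
  Γ̄ = correspondence ⌊ subfield L S ⌋ (corestrict L S π π∈) (corestrict L S φ φ∈)

  project : Γ ↠ Γ̄
  project = record
    { morphism = record
      { v♯ = inclusion L S ; commutes-π = λ _ → refl ; commutes-φ = λ _ → refl }
    ; surjective = specSurjective-fromField (subfield L S) L (inclusion L S) (idₕ ⌊ L ⌋)
    }

  module _
    (S⊆ : S ⊆ Generated L (λ y → (∃[ e ] y ≈ ⟦ π ⟧ e) ⊎ (∃[ e ] y ≈ ⟦ φ ⟧ e))) where

    -- The image of 𝒪Y₁ in L is a field containing π(E) and φ(E), hence contains the compositum.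
    descend : (Γ₁ : Correspondence E) → 𝒞₀ Γ₁ → (m : Γ ↠ Γ₁) →
              Σ (Γ₁ ↠ Γ̄) λ n → ∀ x → ⟦ v♯ m ⟧ (⟦ v♯ n ⟧ x) ≈ proj₁ x
    descend Γ₁ object m = record
      { morphism = record
        { v♯         = n♯
        ; commutes-π = λ x → injective (trans (section (_ , π∈ x)) (sym (m.commutes-π x)))
        ; commutes-φ = λ x → injective (trans (section (_ , φ∈ x)) (sym (m.commutes-φ x)))
        }
      ; surjective = specSurjective-fromField (subfield L S) L n♯ (v♯ m)
      } , section
      where
      module m = _↠_ m

      injective : ∀ {x y} → ⟦ v♯ m ⟧ x ≈ ⟦ v♯ m ⟧ y →
                  CommutativeRing._≈_ (Correspondence.𝒪Y Γ₁) x y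
      injective = specSurjective⇒injective object L (v♯ m) m.surjective

      πφ-image : ∀ {x} → (∃[ e ] x ≈ ⟦ π ⟧ e) ⊎ (∃[ e ] x ≈ ⟦ φ ⟧ e) → ∃[ y ] ⟦ v♯ m ⟧ y ≈ x
      πφ-image (inj₁ (e , x≈πe)) = _ , trans (m.commutes-π e) (sym x≈πe)
      πφ-image (inj₂ (e , x≈φe)) = _ , trans (m.commutes-φ e) (sym x≈φe)

      image : ∀ {x} → x ∈ Generated L S → ∃[ y ] ⟦ v♯ m ⟧ y ≈ x
      image x∈ = Generated-⊆-image L (v♯ m)
        (specSurjective⇒image-inverse object L (v♯ m) m.surjective) πφ-image
        (Generated-⊆ L S⊆ x∈)

      n♯ = liftToDomain L S (v♯ m) injective image
      section = liftToDomain-section L S (v♯ m) injective image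

    -- A morphism `v` out of `Γ̄`, preceded by `project`, descends to a morphism back to `Γ̄`. One
    -- composite is the identity by `section`; the other becomes so after applying the injective map
    -- `v♯ v`.
    categoricallyReduced : 𝒞₀ Γ̄ → IsCategoricallyReduced Γ̄
    categoricallyReduced object = record
      { object  = object
      ; reduced = λ Γ₁ object₁ v →
          let (n , section) = descend Γ₁ object₁ (v ∘↠ project)
          in n , section , λ y →
            specSurjective⇒injective object₁ (subfield L S) (v♯ v) (_↠_.surjective v)
              (section (⟦ v♯ v ⟧ y))
      }

    -- Both `Γ₁` and `Γ₂` map to `Γ̄` by `descend`, and these maps are isomorphisms because `Γ₁` and
    -- `Γ₂` are reduced.
    unique : (Γ₁ Γ₂ : Correspondence E) → 𝒞₀ Γ̄ →
             IsCategoricallyReduced Γ₁ → IsCategoricallyReduced Γ₂ →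
             (m₁ : Γ ↠ Γ₁) (m₂ : Γ ↠ Γ₂) →
             Σ (Γ₁ ↠ Γ₂) λ j → IsIso j × (∀ y → ⟦ v♯ m₁ ⟧ (⟦ v♯ j ⟧ y) ≈ ⟦ v♯ m₂ ⟧ y)
    unique Γ₁ Γ₂ object reduced₁ reduced₂ m₁ m₂ =
      let (n₁ , section₁) = descend Γ₁ (Γ₁.object) m₁
          (n₂ , section₂) = descend Γ₂ (Γ₂.object) m₂
          (n₁⁻¹ , n₁n₁⁻¹ , n₁⁻¹n₁) = Γ₁.reduced Γ̄ object n₁
          (n₂⁻¹ , n₂n₂⁻¹ , n₂⁻¹n₂) = Γ₂.reduced Γ̄ object n₂
      in n₂⁻¹ ∘↠ n₁
       , ∘↠-isIso n₂⁻¹ n₁ (n₂ , n₂⁻¹n₂ , n₂n₂⁻¹) (n₁⁻¹ , n₁n₁⁻¹ , n₁⁻¹n₁)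
       -- Both `m₁` after `n₁` and `m₂` after `n₂` are the inclusion of the subfield, on the level
       -- of rings; then `n₂` cancels against its inverse.
       , λ y → trans (section₁ (⟦ v♯ n₂⁻¹ ⟧ y))
           (trans (sym (section₂ (⟦ v♯ n₂⁻¹ ⟧ y))) (Hom.⟦⟧-cong (v♯ m₂) (n₂n₂⁻¹ y)))
      where
      module Γ₁ = IsCategoricallyReduced reduced₁
      module Γ₂ = IsCategoricallyReduced reduced₂

-- Finite extensions generated by one element

module Horner (K L : Field ℓ) (f : Hom ⌊ K ⌋ ⌊ L ⌋) (t : Field.Carrier L) where
  open Field L
  open FieldProperties L
  open SetoidReasoning setoid
  open SemiringSum semiring using (sum-cong-≋; *-distribʳ-sum)
  open IntegerSolver ⌊ L ⌋
  open Hom f using (⟦⟧-cong; +-homo; *-homo; -‿homo; 0#-homo; 1#-homo)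
  private
    module K = Field K
    module FK = FieldProperties K
    module SK = IntegerSolver ⌊ K ⌋

  private
    variable
      m n N : ℕ
      c d : K.Carrier
      x y : Carrier

  -- x is the value at t of a polynomial over K with leading term c Xⁿ.  The
  -- leading coefficient may vanish.
  data Lead : ℕ → K.Carrier → Carrier → Set ℓ where
    constant : x ≈ ⟦ f ⟧ c → Lead 0 c x
    horner   : ∀ b → Lead n c y → x ≈ y * t + ⟦ f ⟧ b → Lead (ℕ.suc n) c x

  data Deg< : ℕ → Carrier → Set ℓ where
    vanishing : x ≈ 0# → Deg< 0 x
    lead      : Lead n c x → Deg< (ℕ.suc n) x

  Polynomial : Carrier → Set ℓ
  Polynomial x = ∃[ n ] Deg< n x

  Lead-resp : c K.≈ d → x ≈ y → Lead n c x → Lead n d y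
  Lead-resp c≈d x≈y (constant x≈fc) = constant (trans (sym x≈y) (trans x≈fc (⟦⟧-cong c≈d)))
  Lead-resp c≈d x≈y (horner b p x≈) = horner b (Lead-resp c≈d refl p) (trans (sym x≈y) x≈)

  Lead-+ : Lead n c x → Lead n d y → Lead n (c K.+ d) (x + y)
  Lead-+ (constant x≈) (constant y≈) = constant (trans (+-cong x≈ y≈) (sym (+-homo _ _)))
  Lead-+ {x = x} {y = y} (horner {y = x′} b p x≈) (horner {y = y′} b′ q y≈) =
    horner (b K.+ b′) (Lead-+ p q) (begin
      x + y                                          ≈⟨ +-cong x≈ y≈ ⟩
      (x′ * t + ⟦ f ⟧ b) + (y′ * t + ⟦ f ⟧ b′)       ≈⟨ solve 5 (λ x b y b′ t →
        (x :* t :+ b) :+ (y :* t :+ b′) := (x :+ y) :* t :+ (b :+ b′)) refl _ _ _ _ _ ⟩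
      (x′ + y′) * t + (⟦ f ⟧ b + ⟦ f ⟧ b′)           ≈⟨ +-congˡ (+-homo b b′) ⟨
      (x′ + y′) * t + ⟦ f ⟧ (b K.+ b′)               ∎)

  Lead-scale : ∀ b → Lead n c x → Lead n (b K.* c) (⟦ f ⟧ b * x)
  Lead-scale b (constant x≈) = constant (trans (*-congˡ x≈) (sym (*-homo _ _)))
  Lead-scale {x = x} b (horner {y = x′} b′ p x≈) =
    horner (b K.* b′) (Lead-scale b p) (begin
      ⟦ f ⟧ b * x                              ≈⟨ *-congˡ x≈ ⟩
      ⟦ f ⟧ b * (x′ * t + ⟦ f ⟧ b′)            ≈⟨ solve 4 (λ b x b′ t →
        b :* (x :* t :+ b′) := b :* x :* t :+ b :* b′) refl _ _ _ _ ⟩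
      ⟦ f ⟧ b * x′ * t + ⟦ f ⟧ b * ⟦ f ⟧ b′    ≈⟨ +-congˡ (*-homo b b′) ⟨
      ⟦ f ⟧ b * x′ * t + ⟦ f ⟧ (b K.* b′)      ∎)

  Lead-neg : Lead n c x → Lead n (K.- c) (- x)
  Lead-neg {c = c} {x} p = Lead-resp
    (SK.solve 1 (λ c → (SK.:- SK.con (+ 1)) SK.:* c SK.:= SK.:- c) K.refl c)
    (trans (*-congʳ (trans (-‿homo _) (-‿cong 1#-homo)))
      (solve 1 (λ x → (:- con (+ 1)) :* x := :- x) refl x))
    (Lead-scale (K.- K.1#) p)

  Lead-- : Lead n c x → Lead n d y → Lead n (c K.- d) (x - y)
  Lead-- p q = Lead-+ p (Lead-neg q)

  Lead-*t : Lead n c x → Lead (ℕ.suc n) c (x * t)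
  Lead-*t p = horner K.0# p (sym (trans (+-congˡ 0#-homo) (+-identityʳ _)))

  Lead-t^ : ∀ n → Lead n K.1# (t ^ n)
  Lead-t^ ℕ.zero    = constant (sym 1#-homo)
  Lead-t^ (ℕ.suc n) = Lead-resp K.refl (*-comm _ _) (Lead-*t (Lead-t^ n))

  Lead-raise₁ : Lead n c x → Lead (ℕ.suc n) K.0# x
  Lead-raise₁ {c = c} {x} (constant x≈) = horner c (constant refl) (begin
    x                            ≈⟨ x≈ ⟩
    ⟦ f ⟧ c                      ≈⟨ +-identityˡ _ ⟨
    0# + ⟦ f ⟧ c                 ≈⟨ +-congʳ (trans (*-congʳ 0#-homo) (zeroˡ t)) ⟨
    ⟦ f ⟧ K.0# * t + ⟦ f ⟧ c     ∎)
  Lead-raise₁ (horner b p x≈) = horner b (Lead-raise₁ p) x≈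

  -- At least one raise is built into the index, since only then is the leading coefficient known to
  -- be zero.
  Lead-raise : ∀ k → Lead n c x → Lead (ℕ.suc k ℕ.+ n) K.0# x
  Lead-raise ℕ.zero    p = Lead-raise₁ p
  Lead-raise (ℕ.suc k) p = Lead-raise₁ (Lead-raise k p)

  Lead-const : ∀ n c → Lead (ℕ.suc n) K.0# (⟦ f ⟧ c)
  Lead-const n c = ≡.subst (λ k → Lead (ℕ.suc k) K.0# (⟦ f ⟧ c)) (ℕ.+-identityʳ n)
    (Lead-raise n (constant refl))

  Lead-+const : ∀ b → Lead (ℕ.suc n) c x → Lead (ℕ.suc n) c (x + ⟦ f ⟧ b)
  Lead-+const b p = Lead-resp (K.+-identityʳ _) refl (Lead-+ p (Lead-const _ b))

  Lead-* : Lead m c x → Lead n d y → Lead (m ℕ.+ n) (c K.* d) (x * y)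
  Lead-* {c = c} (constant x≈) q = Lead-resp K.refl (*-congʳ (sym x≈)) (Lead-scale c q)
  Lead-* {x = x} {y = y} (horner {y = x′} b p x≈) q =
    Lead-resp (K.+-identityʳ _) eq (Lead-+ (Lead-*t (Lead-* p q)) (Lead-raise _ (Lead-scale b q)))
    where
    eq : x′ * y * t + ⟦ f ⟧ b * y ≈ x * y
    eq = trans
      (solve 4 (λ x b y t → x :* y :* t :+ b :* y := (x :* t :+ b) :* y) refl _ _ _ _)
      (*-congʳ (sym x≈))

  Lead-^ : Lead n c x → ∀ k → Lead (k ℕ.* n) (c K.^ k) (x ^ k)
  Lead-^ p ℕ.zero    = constant (sym 1#-homo)
  Lead-^ p (ℕ.suc k) = Lead-* p (Lead-^ p k)

  Deg<-resp : x ≈ y → Deg< n x → Deg< n y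
  Deg<-resp x≈y (vanishing x≈0) = vanishing (trans (sym x≈y) x≈0)
  Deg<-resp x≈y (lead p)        = lead (Lead-resp K.refl x≈y p)

  horner-step : ∀ b → Deg< n x → ∃[ c ] Lead n c (x * t + ⟦ f ⟧ b)
  horner-step b (vanishing x≈0) =
    b , constant (trans (+-congʳ (trans (*-congʳ x≈0) (zeroˡ t))) (+-identityˡ _))
  horner-step b (lead p)        = _ , horner b p refl

  Lead-0⇒Deg< : c K.≈ K.0# → Lead n c x → Deg< n x
  Lead-0⇒Deg< c≈0 (constant x≈) = vanishing (trans x≈ (trans (⟦⟧-cong c≈0) 0#-homo))
  Lead-0⇒Deg< c≈0 (horner b p x≈) =
    Deg<-resp (sym x≈) (lead (proj₂ (horner-step b (Lead-0⇒Deg< c≈0 p))))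

  Deg<-0 : ∀ n → Deg< n 0#
  Deg<-0 ℕ.zero    = vanishing refl
  Deg<-0 (ℕ.suc n) = Deg<-resp
    (trans (+-congˡ 0#-homo) (trans (+-identityʳ _) (zeroˡ t)))
    (lead (proj₂ (horner-step K.0# (Deg<-0 n))))

  -- Equality in `K` is decidable, so vanishing leading coefficients can be stripped until a nonzero
  -- one appears or nothing is left.
  Deg<⇒0∨Lead : ∀ n → Deg< n x → x ≈ 0# ⊎ ∃[ m ] ∃[ c ] (m < n × ¬ c K.≈ K.0# × Lead m c x)
  Deg<⇒0∨Lead ℕ.zero (vanishing x≈0) = inj₁ x≈0
  Deg<⇒0∨Lead (ℕ.suc n) (lead {c = c} p) with c K.≟ K.0#
  ... | no  c≉0 = inj₂ (n , c , ℕ.≤-refl , c≉0 , p)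
  ... | yes c≈0 with Deg<⇒0∨Lead n (Lead-0⇒Deg< c≈0 p)
  ...   | inj₁ x≈0                     = inj₁ x≈0
  ...   | inj₂ (m , d , m<n , d≉0 , q) = inj₂ (m , d , ℕ.m<n⇒m<1+n m<n , d≉0 , q)

  eliminateLead : ¬ d K.≈ K.0# → Lead n d y → Lead n c x → Deg< n (x - ⟦ f ⟧ (c K./ d) * y)
  eliminateLead d≉0 q p = Lead-0⇒Deg<
    (K.trans (K.+-congˡ (K.-‿cong (FK.x/y*y≈x _ d≉0))) (K.-‿inverseʳ _))
    (Lead-- p (Lead-scale _ q))

  -- Long division along the Horner form: if x′ = q y + r, then x′ t + e = (q t) y + (r t + e), and
  -- one more cancellation brings r t + e below degree `m`. The equation for `b` later shows that
  -- the quotient has a nonzero leading coefficient.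
  divide : ¬ d K.≈ K.0# → Lead m d y → ∀ k → Lead (k ℕ.+ m) c x →
           ∃[ q ] ∃[ b ] (b K.* d K.≈ c × Lead k b q × Deg< m (x - q * y))
  divide {d} {y = y} {c} {x} d≉0 p ℕ.zero r =
    ⟦ f ⟧ (c K./ d) , c K./ d , FK.x/y*y≈x c d≉0 , constant refl , eliminateLead d≉0 p r
  divide {d} {m} {y} {c} {x} d≉0 p (ℕ.suc k) (horner {y = x′} e r x≈) =
    q * t + ⟦ f ⟧ h , b , bd≈c , horner h q-lead refl , Deg<-resp eq (eliminateLead d≉0 p (proj₂ rest))
    where
    quotient = divide d≉0 p k r
    q      = proj₁ quotient
    b      = proj₁ (proj₂ quotient)
    bd≈c   = proj₁ (proj₂ (proj₂ quotient))
    q-lead = proj₁ (proj₂ (proj₂ (proj₂ quotient)))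
    rest   = horner-step e (proj₂ (proj₂ (proj₂ (proj₂ quotient))))
    -- The new remainder can have degree `m`, one too many; `h` is the constant term of the quotient
    -- that cancels its leading term.
    h      = proj₁ rest K./ d
    eq : (x′ - q * y) * t + ⟦ f ⟧ e - ⟦ f ⟧ h * y ≈ x - (q * t + ⟦ f ⟧ h) * y
    eq = trans
      (solve 6 (λ x q y t e h → (x :- q :* y) :* t :+ e :- h :* y
                             := (x :* t :+ e) :- (q :* t :+ h) :* y) refl _ _ _ _ _ _)
      (+-congʳ (sym x≈))

  Polynomial-resp : x ≈ y → Polynomial x → Polynomial y
  Polynomial-resp x≈y (n , p) = n , Deg<-resp x≈y p

  Polynomial-const : ∀ c → Polynomial (⟦ f ⟧ c)
  Polynomial-const c = 1 , lead (constant refl)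

  Polynomial-0 : x ≈ 0# → Polynomial x
  Polynomial-0 x≈0 = 0 , vanishing x≈0

  Polynomial-+ : Polynomial x → Polynomial y → Polynomial (x + y)
  Polynomial-+ (_ , vanishing x≈0) q =
    Polynomial-resp (sym (trans (+-congʳ x≈0) (+-identityˡ _))) q
  Polynomial-+ p@(_ , lead _) (_ , vanishing y≈0) =
    Polynomial-resp (sym (trans (+-congˡ y≈0) (+-identityʳ _))) p
  Polynomial-+ {y = y} (_ , lead {n = m} p) (_ , lead {n = n} q) = _ , lead (Lead-+ (Lead-raise n p)
    (≡.subst (λ k → Lead (ℕ.suc k) K.0# y) (ℕ.+-comm m n) (Lead-raise m q)))

  Polynomial-* : Polynomial x → Polynomial y → Polynomial (x * y)
  Polynomial-* (_ , vanishing x≈0) _ = Polynomial-0 (trans (*-congʳ x≈0) (zeroˡ _))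
  Polynomial-* (_ , lead _) (_ , vanishing y≈0) = Polynomial-0 (trans (*-congˡ y≈0) (zeroʳ _))
  Polynomial-* (_ , lead p) (_ , lead q) = _ , lead (Lead-* p q)

  Polynomial-neg : Polynomial x → Polynomial (- x)
  Polynomial-neg (_ , vanishing x≈0) =
    Polynomial-0 (trans (-‿cong x≈0) (solve 0 (:- con (+ 0) := con (+ 0)) refl))
  Polynomial-neg (_ , lead p) = _ , lead (Lead-neg p)

  -- An equation for `t` over `K` of degree exactly `n`, neither monic nor minimal in general.
  Relation : ℕ → Set ℓ
  Relation n = ∃[ c ] (¬ c K.≈ K.0# × Lead n c 0#)

  -- Horner evaluation modulo the relation: each multiplication by `t` produces degree at most `N`,
  -- and subtracting a multiple of the relation, whose value is 0, lowers the degree without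
  -- changing the value.
  reduce : Relation N → Lead n c x → Deg< N x
  reduce {N} rel@(e , e≉0 , rel-lead) = λ where
      (constant x≈)   → Deg<-resp
        (trans (+-congʳ (zeroˡ t)) (trans (+-identityˡ _) (sym x≈))) (step _ (Deg<-0 N))
      (horner b p x≈) → Deg<-resp (sym x≈) (step b (reduce rel p))
    where
    step : ∀ {x} b → Deg< N x → Deg< N (x * t + ⟦ f ⟧ b)
    step b p = Deg<-resp
      (solve 2 (λ x h → x :- h :* con (+ 0) := x) refl _ _)
      (eliminateLead e≉0 rel-lead (proj₂ (horner-step b p)))

  Invertible : Carrier → Set ℓ
  Invertible x = ∃[ y ] Polynomial y × x * y ≈ 1#

  -- Dividing the relation by x, either the remainder is invertible by induction on the
  -- degree of x, or the quotient (or x itself) is a shorter relation.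
  invert∨shorten : Relation N → ∀ {m} → Acc _<_ m → m < N → ¬ c K.≈ K.0# → Lead m c x →
                   Invertible x ⊎ ∃[ n ] n < N × Relation n
  invert∨shorten {c = c} rel {ℕ.zero} _ _ c≉0 (constant x≈) =
    let (c′ , cc′≈1) = K.inverses c c≉0 in
    inj₁ (⟦ f ⟧ c′ , (1 , lead (constant refl)) ,
      trans (*-congʳ x≈) (FieldHom.inverse-homo K f cc′≈1))
  invert∨shorten {N} {c} {x} rel@(e , e≉0 , rel-lead) {m@(ℕ.suc m′)} (acc rec) m<N c≉0 p with x ≟ 0#
  ... | yes x≈0 = inj₂ (m , m<N , c , c≉0 , Lead-resp K.refl x≈0 p)
  ... | no  x≉0 with divide c≉0 p (N ℕ.∸ m)
                       (≡.subst (λ n → Lead n e 0#) (≡.sym (ℕ.m∸n+n≡m (ℕ.<⇒≤ m<N))) rel-lead)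
  ...   | q , b , bc≈e , q-lead , r with Deg<⇒0∨Lead m r
  ...     | inj₁ -qx≈0 = inj₂ (N ℕ.∸ m , k<N , b , b≉0 , Lead-resp K.refl q≈0 q-lead)
    where
    k<N : N ℕ.∸ m < N
    k<N = ℕ.∸-monoʳ-< z<s (ℕ.<⇒≤ m<N)
    b≉0 : ¬ b K.≈ K.0#
    b≉0 = FK.x*y≉0⇒x≉0 λ bc≈0 → e≉0 (K.trans (K.sym bc≈e) bc≈0)
    q≈0 : q ≈ 0#
    q≈0 = *-cancelˡ-0 x≉0 (trans
      (solve 2 (λ x q → x :* q := :- (con (+ 0) :- q :* x)) refl x q)
      (trans (-‿cong -qx≈0) (solve 0 (:- con (+ 0) := con (+ 0)) refl)))
  ...     | inj₂ (m″ , d , m″<m , d≉0 , r-lead)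
      with invert∨shorten rel (rec m″<m) (ℕ.<-trans m″<m m<N) d≉0 r-lead
  ...       | inj₂ shorter = inj₂ shorter
  ...       | inj₁ (y , (n , y-poly) , ry≈1) = inj₁
    ( - (q * y) , Polynomial-neg (Polynomial-* (_ , lead q-lead) (n , y-poly))
    , trans (solve 3 (λ x q y → x :* (:- (q :* y)) := (con (+ 0) :- q :* x) :* y) refl x q y) ry≈1)

  -- Induction on the degree of the relation. No minimal polynomial is computed: whenever inversion
  -- fails, it has produced a shorter relation, with which the argument restarts.
  invert : Acc _<_ N → Relation N → Polynomial x → ¬ x ≈ 0# → Invertible x
  invert _ _ (_ , vanishing x≈0) x≉0 = contradiction x≈0 x≉0
  invert {N} (acc rec) rel poly@(_ , lead p) x≉0 with Deg<⇒0∨Lead N (reduce rel p)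
  ... | inj₁ x≈0 = contradiction x≈0 x≉0
  ... | inj₂ (m , d , m<N , d≉0 , q) with invert∨shorten rel (<-wellFounded m) m<N d≉0 q
  ...   | inj₁ invertible         = invertible
  ...   | inj₂ (k , k<N , rel′)   = invert (rec k<N) rel′ poly x≉0

  module _ (rel : Relation N) {S : Pred Carrier ℓ} (S⊆ : ∀ {x} → x ∈ S → Polynomial x) where

    Generated⇒Polynomial : x ∈ Generated L S → Polynomial x
    Generated⇒Polynomial (gen x∈S)     = S⊆ x∈S
    Generated⇒Polynomial (resp x≈y x∈) = Polynomial-resp x≈y (Generated⇒Polynomial x∈)
    Generated⇒Polynomial 0∈            = Polynomial-0 refl
    Generated⇒Polynomial 1∈            = Polynomial-resp 1#-homo (Polynomial-const K.1#)
    Generated⇒Polynomial (+∈ x∈ y∈)    =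
      Polynomial-+ (Generated⇒Polynomial x∈) (Generated⇒Polynomial y∈)
    Generated⇒Polynomial (*∈ x∈ y∈)    =
      Polynomial-* (Generated⇒Polynomial x∈) (Generated⇒Polynomial y∈)
    Generated⇒Polynomial (-∈ x∈)       = Polynomial-neg (Generated⇒Polynomial x∈)
    Generated⇒Polynomial (⁻¹∈ x∈ xy≈1) =
      let x≉0 = x*y≈1⇒x≉0 xy≈1
          (y′ , p , xy′≈1) = invert (<-wellFounded _) rel (Generated⇒Polynomial x∈) x≉0
      in Polynomial-resp (*-cancelˡ x≉0 (trans xy′≈1 (sym xy≈1))) p

    Generated⇒Deg< : x ∈ Generated L S → Deg< N x
    Generated⇒Deg< x∈ with Generated⇒Polynomial x∈
    ... | _ , vanishing x≈0 = Deg<-resp (sym x≈0) (Deg<-0 N)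
    ... | _ , lead p        = reduce rel p

  evaluate : ∀ {n} → (Fin n → K.Carrier) → Carrier
  evaluate c = sum (λ i → ⟦ f ⟧ (c i) * t ^ toℕ i)

  -- The top coefficient is recorded up to `≡`, so that it can be eliminated by matching in
  -- `t-transcendental`.
  Lead⇒evaluate : Lead n c x →
                  Σ (Fin (ℕ.suc n) → K.Carrier) λ e → x ≈ evaluate e × e (fromℕ n) ≡ c
  Lead⇒evaluate {c = c} {x} (constant x≈) = (λ _ → c) ,
    trans x≈ (solve 1 (λ c → c := c :* con (+ 1) :+ con (+ 0)) refl _) , ≡.refl
  Lead⇒evaluate {ℕ.suc n} {c} {x} (horner {y = y} b p x≈) =
    let (e , y≈ , e-lead) = Lead⇒evaluate p in
    (λ { zero → b ; (suc i) → e i }) , (begin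
      x                                                              ≈⟨ x≈ ⟩
      y * t + ⟦ f ⟧ b                                                ≈⟨ +-congʳ (*-congʳ y≈) ⟩
      evaluate e * t + ⟦ f ⟧ b                                       ≈⟨ +-comm _ _ ⟩
      ⟦ f ⟧ b + evaluate e * t                                       ≈⟨ +-cong (sym (*-identityʳ _))
        (trans (*-distribʳ-sum {ℕ.suc n} t (λ i → ⟦ f ⟧ (e i) * t ^ toℕ i))
          (sum-cong-≋ {ℕ.suc n} λ i →
            solve 3 (λ c p t → c :* p :* t := c :* (t :* p)) refl (⟦ f ⟧ (e i)) (t ^ toℕ i) t)) ⟩
      ⟦ f ⟧ b * 1# + sum (λ i → ⟦ f ⟧ (e i) * (t * t ^ toℕ i))       ∎) , e-lead

  Deg<⇒evaluate : Deg< n x → Σ (Fin n → K.Carrier) λ e → x ≈ evaluate e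
  Deg<⇒evaluate (vanishing x≈0) = (λ ()) , x≈0
  Deg<⇒evaluate (lead p) = let (e , x≈ , _) = Lead⇒evaluate p in e , x≈

  Polynomial-t : Polynomial t
  Polynomial-t = _ , lead (Lead-resp K.refl (*-identityʳ t) (Lead-t^ 1))

  -- The powers of `t` below the degree of the relation span: inverses of polynomials in `t` are
  -- polynomials in `t`, and all of them reduce to degree less than `N`.
  corestrict-isFinite : Relation N → (S : Pred Carrier ℓ) (f∈ : ∀ e → ⟦ f ⟧ e ∈ Generated L S) →
    t ∈ Generated L S → S ⊆ Generated L (λ y → (∃[ e ] y ≈ ⟦ f ⟧ e) ⊎ y ≈ t) →
    IsFinite (corestrict L S f f∈)
  corestrict-isFinite {N} rel S f∈ t∈ S⊆ =
    N , (λ i → t ^ toℕ i , ^∈ L t∈ (toℕ i)) , λ (x , x∈) →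
      let (e , x≈) = Deg<⇒evaluate (Generated⇒Deg< rel generators (Generated-⊆ L S⊆ x∈))
      in e , trans x≈ (sym (HomProperties.sum-homo (inclusion L S) {N} _))
    where
    generators : ∀ {y} → (∃[ e ] y ≈ ⟦ f ⟧ e) ⊎ y ≈ t → Polynomial y
    generators (inj₁ (e , y≈fe)) = Polynomial-resp (sym y≈fe) (Polynomial-const e)
    generators (inj₂ y≈t)        = Polynomial-resp (sym y≈t) Polynomial-t

-- The field F(α, β)

module _ (R : CommutativeRing a ℓ₁) where
  open RingOps R

  sum-single : ∀ {n} (k : Fin n) (x : Fin n → Carrier) →
               (∀ j → j ≢ k → x j ≈ 0#) → sum x ≈ x k
  sum-single {ℕ.suc n} zero x x≈0 = trans
    (+-congˡ (trans (sum-cong-≋ {n} λ j → x≈0 (suc j) λ ()) (sum-replicate-zero n)))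
    (+-identityʳ _)
    where open SemiringSum semiring
  sum-single (suc k) x x≈0 = trans (+-congʳ (x≈0 zero λ ()))
    (trans (+-identityˡ _)
      (sum-single k (λ j → x (suc j)) λ j j≢k → x≈0 (suc j) λ eq → j≢k (Fin.suc-injective eq)))

module _ (F : NumberField ℓ) where
  open NumberField F

  -- `F` contains ℚ, where 2 has the inverse 1/2.
  1+1≉0 : ¬ 1# + 1# ≈ 0#
  1+1≉0 2≈0 = 1≉0 (begin
    1#                                        ≈⟨ 1#-homo ⟨
    Hom.⟦ ι ⟧ ((ℚ.1ℚ ℚ.+ ℚ.1ℚ) ℚ.* ℚ.½)       ≈⟨ *-homo _ _ ⟩
    Hom.⟦ ι ⟧ (ℚ.1ℚ ℚ.+ ℚ.1ℚ) * Hom.⟦ ι ⟧ ℚ.½ ≈⟨ *-congʳ (+-homo _ _) ⟩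
    (Hom.⟦ ι ⟧ ℚ.1ℚ + Hom.⟦ ι ⟧ ℚ.1ℚ) * Hom.⟦ ι ⟧ ℚ.½
                                              ≈⟨ *-congʳ (+-cong 1#-homo 1#-homo) ⟩
    (1# + 1#) * Hom.⟦ ι ⟧ ℚ.½                 ≈⟨ *-congʳ 2≈0 ⟩
    0# * Hom.⟦ ι ⟧ ℚ.½                        ≈⟨ zeroˡ _ ⟩
    0#                                        ∎)
    where
    open Hom ι using (*-homo; +-homo; 1#-homo)
    open SetoidReasoning setoid

module FunctionField (F : Field ℓ) (R : RationalFunctionField F) where
  open RationalFunctionField R
  open Field E′
  open FieldProperties E′
  open SetoidReasoning setoid
  open SemiringSum semiring using (sum-cong-≋; *-distribʳ-sum)
  open ExpProperties commutativeSemiring using (^-congˡ; ^-congʳ; ^-homo-*; ^-distrib-*)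
  open IntegerSolver ⌊ E′ ⌋
  open Hom κ using (⟦⟧-cong; 0#-homo; 1#-homo)
  open Horner F E′ κ t
  private module F = Field F

  -- Otherwise there would be a relation with coefficient 1 at the monomial β.
  β≉0 : ¬ β ≈ 0#
  β≉0 β≈0 = F.1≉0 (independent 1 2 c (begin
    ⟦ κ ⟧ F.0# * (1# * 1#) + (⟦ κ ⟧ F.1# * (1# * (β * 1#)) + 0#) + 0#
      ≈⟨ +-congʳ (+-cong (*-congʳ 0#-homo) (+-congʳ (*-congˡ (*-congˡ (*-congʳ β≈0))))) ⟩
    0# * (1# * 1#) + (⟦ κ ⟧ F.1# * (1# * (0# * 1#)) + 0#) + 0#
      ≈⟨ solve 1 (λ z → con (+ 0) :* (con (+ 1) :* con (+ 1))
                        :+ (z :* (con (+ 1) :* (con (+ 0) :* con (+ 1))) :+ con (+ 0)) :+ con (+ 0)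
                     := con (+ 0)) refl _ ⟩
    0#  ∎) zero (suc zero))
    where
    c : Fin 1 → Fin 2 → F.Carrier
    c zero zero    = F.0#
    c zero (suc _) = F.1#

  t*β≈α : t * β ≈ α
  t*β≈α = x/y*y≈x α β≉0

  α^i*β^n-i : ∀ {n} (i : Fin (ℕ.suc n)) → α ^ toℕ i * β ^ toℕ (opposite i) ≈ t ^ toℕ i * β ^ n
  α^i*β^n-i {n} i = begin
    α ^ toℕ i * β ^ toℕ (opposite i)                ≈⟨ *-congʳ (^-congˡ (toℕ i) t*β≈α) ⟨
    (t * β) ^ toℕ i * β ^ toℕ (opposite i)          ≈⟨ *-congʳ (^-distrib-* t β (toℕ i)) ⟩
    t ^ toℕ i * β ^ toℕ i * β ^ toℕ (opposite i)    ≈⟨ *-assoc _ _ _ ⟩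
    t ^ toℕ i * (β ^ toℕ i * β ^ toℕ (opposite i))  ≈⟨ *-congˡ (^-homo-* β (toℕ i) _) ⟨
    t ^ toℕ i * β ^ (toℕ i ℕ.+ toℕ (opposite i))    ≈⟨ *-congˡ (^-congʳ β degree) ⟩
    t ^ toℕ i * β ^ n                               ∎
    where
    degree : toℕ i ℕ.+ toℕ (opposite i) ≡ n
    degree = ≡.trans (≡.cong (toℕ i ℕ.+_) (Fin.opposite-prop i)) (ℕ.m+[n∸m]≡n (Fin.toℕ≤pred[n] i))

  -- A relation Σ cᵢ tⁱ = 0, multiplied by βⁿ, is the relation Σ cᵢ αⁱ βⁿ⁻ⁱ = 0.
  t-transcendental : ∀ {n c} → Lead n c 0# → c F.≈ F.0#
  t-transcendental {n} p with Lead⇒evaluate p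
  ... | e , 0≈ , ≡.refl = F.trans (F.sym (C-diagonal (fromℕ n)))
          (independent (ℕ.suc n) (ℕ.suc n) C relation (fromℕ n) (opposite (fromℕ n)))
    where
    C : Fin (ℕ.suc n) → Fin (ℕ.suc n) → F.Carrier
    C i j with j Fin.≟ opposite i
    ... | yes _ = e i
    ... | no  _ = F.0#

    C-diagonal : ∀ i → C i (opposite i) F.≈ e i
    C-diagonal i with opposite i Fin.≟ opposite i
    ... | yes _  = F.refl
    ... | no neq = contradiction ≡.refl neq

    C-off-diagonal : ∀ i j → j ≢ opposite i → C i j F.≈ F.0#
    C-off-diagonal i j neq with j Fin.≟ opposite i
    ... | yes eq = contradiction eq neq
    ... | no _   = F.refl

    row : ∀ i → sum (λ j → ⟦ κ ⟧ (C i j) * (α ^ toℕ i * β ^ toℕ j)) ≈ ⟦ κ ⟧ (e i) * t ^ toℕ i * β ^ n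
    row i = begin
      sum (λ j → ⟦ κ ⟧ (C i j) * (α ^ toℕ i * β ^ toℕ j))
        ≈⟨ sum-single ⌊ E′ ⌋ (opposite i) (λ j → ⟦ κ ⟧ (C i j) * (α ^ toℕ i * β ^ toℕ j)) (λ j neq →
             trans (*-congʳ (trans (⟦⟧-cong (C-off-diagonal i j neq)) 0#-homo)) (zeroˡ _)) ⟩
      ⟦ κ ⟧ (C i (opposite i)) * (α ^ toℕ i * β ^ toℕ (opposite i))
        ≈⟨ *-cong (⟦⟧-cong (C-diagonal i)) (α^i*β^n-i i) ⟩
      ⟦ κ ⟧ (e i) * (t ^ toℕ i * β ^ n)
        ≈⟨ *-assoc _ _ _ ⟨
      ⟦ κ ⟧ (e i) * t ^ toℕ i * β ^ n  ∎

    relation : sum (λ i → sum (λ j → ⟦ κ ⟧ (C i j) * (α ^ toℕ i * β ^ toℕ j))) ≈ 0#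
    relation = begin
      sum (λ i → sum (λ j → ⟦ κ ⟧ (C i j) * (α ^ toℕ i * β ^ toℕ j)))  ≈⟨ sum-cong-≋ {ℕ.suc n} row ⟩
      sum (λ i → ⟦ κ ⟧ (e i) * t ^ toℕ i * β ^ n)                      ≈⟨ *-distribʳ-sum {ℕ.suc n} (β ^ n) (λ i → ⟦ κ ⟧ (e i) * t ^ toℕ i) ⟨
      sum (λ i → ⟦ κ ⟧ (e i) * t ^ toℕ i) * β ^ n                      ≈⟨ *-congʳ 0≈ ⟨
      0# * β ^ n                                                       ≈⟨ zeroˡ _ ⟩
      0#                                                               ∎

  Lead-≉0 : ∀ {n c x} → ¬ c F.≈ F.0# → Lead n c x → ¬ x ≈ 0#
  Lead-≉0 c≉0 p x≈0 = c≉0 (t-transcendental (Lead-resp F.refl x≈0 p))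

  -- This is a polynomial in `t` with leading coefficient 1. Its degree is positive, so the constant
  -- 1 does not disturb the leading coefficient.
  t²ᵖ+1≉0 : ∀ p → .{{ℕ.NonZero p}} → ¬ t ^ p * t ^ p + 1# ≈ 0#
  t²ᵖ+1≉0 p@(ℕ.suc _) = Lead-≉0 (λ 1*1≈0 → F.1≉0 (F.trans (F.sym (F.*-identityˡ _)) 1*1≈0))
    (Lead-resp F.refl (+-congˡ 1#-homo)
      (Lead-+const F.1# (Lead-* (Lead-t^ p) (Lead-t^ p))))

-- The correspondences Γ′ₚᵢ

module _ (R : CommutativeRing a ℓ₁) where
  open RingOps R
  open IntegerSolver R

  -- The sign of `v` in the upper right entry of `twist`. It lets one computation cover both
  -- correspondences.
  ε : Fin 2 → Carrier
  ε zero    = 1#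
  ε (suc _) = - 1#

  ε*ε≈1 : ∀ i → ε i * ε i ≈ 1#
  ε*ε≈1 zero    = *-identityˡ 1#
  ε*ε≈1 (suc _) = solve 0 ((:- con (+ 1)) :* (:- con (+ 1)) := con (+ 1)) refl

ε-homo : {R S : CommutativeRing a ℓ₁} (f : Hom R S) →
         ∀ i → CommutativeRing._≈_ S (⟦ f ⟧ (ε R i)) (ε S i)
ε-homo         f zero    = Hom.1#-homo f
ε-homo {S = S} f (suc _) = trans (Hom.-‿homo f _) (-‿cong (Hom.1#-homo f))
  where open CommutativeRing S

module LeviCivitaProperties
  (F : NumberField ℓ) (p-1 : ℕ) (φₚ : NumberField.Gal F)
  (d : NumberField.Carrier F) (d≉0 : ¬ NumberField._≈_ F d (NumberField.0# F))
  (R : RationalFunctionField (NumberField.field′ F)) (G : LeviCivita F (ℕ.suc p-1) φₚ d R)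
  where
  private
    p = ℕ.suc p-1
    module F = NumberField F
    module FF = FieldProperties F.field′
  open RationalFunctionField R
  open FunctionField F.field′ R using (β≉0; t*β≈α; t-transcendental; t²ᵖ+1≉0)

  φₚd≉0 : ¬ φₚ F.⟨$⟩ d F.≈ F.0#
  φₚd≉0 = FieldHom.≉0-homo F.field′ (F.Gal.hom φₚ) F.1≉0 d≉0

  -- θₚ as a rational function of t

  module θ-Properties where
    open Field E′
    open FieldProperties E′
    open SetoidReasoning setoid
    open ExpProperties commutativeSemiring using (^-congˡ; ^-congʳ; ^-homo-*; ^-distrib-*)
    open IntegerSolver ⌊ E′ ⌋

    private
      θ  = θₚ F p φₚ d R
      tᵖ = t ^ p
      βᵖ = β ^ p
      κφd = ⟦ κ ⟧ (φₚ F.⟨$⟩ d)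
      denominator = κφd * (α ^ (2 ℕ.* p) + β ^ (2 ℕ.* p))

      ^-2* : ∀ x → x ^ (2 ℕ.* p) ≈ x ^ p * x ^ p
      ^-2* x = trans (^-homo-* x p _) (*-congˡ (^-congʳ x (ℕ.+-identityʳ p)))

      αᵖ≈tᵖβᵖ : α ^ p ≈ tᵖ * βᵖ
      αᵖ≈tᵖβᵖ = trans (^-congˡ p (sym t*β≈α)) (^-distrib-* t β p)

      denominator≈ : denominator ≈ κφd * (tᵖ * tᵖ + 1#) * (βᵖ * βᵖ)
      denominator≈ = begin
        κφd * (α ^ (2 ℕ.* p) + β ^ (2 ℕ.* p))
          ≈⟨ *-congˡ (+-cong (trans (^-2* α) (*-cong αᵖ≈tᵖβᵖ αᵖ≈tᵖβᵖ)) (^-2* β)) ⟩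
        κφd * (tᵖ * βᵖ * (tᵖ * βᵖ) + βᵖ * βᵖ)
          ≈⟨ solve 3 (λ k t b → k :* (t :* b :* (t :* b) :+ b :* b)
                             := k :* (t :* t :+ con (+ 1)) :* (b :* b)) refl κφd tᵖ βᵖ ⟩
        κφd * (tᵖ * tᵖ + 1#) * (βᵖ * βᵖ)  ∎

      numerator≈ : ⟦ κ ⟧ d ^ p * (α ^ 2 + β ^ 2) ^ p ≈
                   ⟦ κ ⟧ (d F.^ p) * (t * t + 1#) ^ p * (βᵖ * βᵖ)
      numerator≈ = begin
        ⟦ κ ⟧ d ^ p * (α * (α * 1#) + β * (β * 1#)) ^ p
          ≈⟨ *-cong (sym (HomProperties.^-homo κ d p)) (^-congˡ p (begin
               α * (α * 1#) + β * (β * 1#)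
                 ≈⟨ +-congʳ (*-cong t*β≈α (*-congʳ t*β≈α)) ⟨
               t * β * (t * β * 1#) + β * (β * 1#)
                 ≈⟨ solve 2 (λ t b → t :* b :* (t :* b :* con (+ 1)) :+ b :* (b :* con (+ 1))
                                  := (t :* t :+ con (+ 1)) :* (b :* b)) refl t β ⟩
               (t * t + 1#) * (β * β) ∎)) ⟩
        ⟦ κ ⟧ (d F.^ p) * ((t * t + 1#) * (β * β)) ^ p
          ≈⟨ *-congˡ (trans (^-distrib-* _ _ p) (*-congˡ (^-distrib-* β β p))) ⟩
        ⟦ κ ⟧ (d F.^ p) * ((t * t + 1#) ^ p * (βᵖ * βᵖ))
          ≈⟨ *-assoc _ _ _ ⟨
        ⟦ κ ⟧ (d F.^ p) * (t * t + 1#) ^ p * (βᵖ * βᵖ)  ∎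

      κφd*[t²ᵖ+1]≉0 : ¬ κφd * (tᵖ * tᵖ + 1#) ≈ 0#
      κφd*[t²ᵖ+1]≉0 = *-≉0 (FieldHom.≉0-homo F.field′ κ 1≉0 φₚd≉0) (t²ᵖ+1≉0 p)

      βᵖ*βᵖ≉0 : ¬ βᵖ * βᵖ ≈ 0#
      βᵖ*βᵖ≉0 = *-≉0 (^-≉0 β≉0 p) (^-≉0 β≉0 p)

      denominator≉0 : ¬ denominator ≈ 0#
      denominator≉0 eq = *-≉0 κφd*[t²ᵖ+1]≉0 βᵖ*βᵖ≉0 (trans (sym denominator≈) eq)

    -- θₚ is homogeneous of degree 0 in α and β: after substituting α = t β, the numerator and the
    -- denominator both carry the factor β²ᵖ, which cancels.
    θ-relation : θ * (κφd * (tᵖ * tᵖ + 1#)) ≈ ⟦ κ ⟧ (d F.^ p) * (t * t + 1#) ^ p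
    θ-relation = *-cancelˡ βᵖ*βᵖ≉0 (begin
      βᵖ * βᵖ * (θ * (κφd * (tᵖ * tᵖ + 1#)))             ≈⟨ solve 3 (λ b θ k →
        b :* (θ :* k) := θ :* (k :* b)) refl _ θ _ ⟩
      θ * (κφd * (tᵖ * tᵖ + 1#) * (βᵖ * βᵖ))             ≈⟨ *-congˡ denominator≈ ⟨
      θ * denominator                                    ≈⟨ x/y*y≈x _ denominator≉0 ⟩
      ⟦ κ ⟧ d ^ p * (α ^ 2 + β ^ 2) ^ p                  ≈⟨ numerator≈ ⟩
      ⟦ κ ⟧ (d F.^ p) * (t * t + 1#) ^ p * (βᵖ * βᵖ)     ≈⟨ *-comm _ _ ⟩
      βᵖ * βᵖ * (⟦ κ ⟧ (d F.^ p) * (t * t + 1#) ^ p)     ∎)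

    κ∈ : ∀ r → ⟦ κ ⟧ r ∈ Generated E′ F∪t
    κ∈ r = gen (inj₁ (r , refl))

    t∈ : t ∈ Generated E′ F∪t
    t∈ = gen (inj₂ refl)

    -- This puts the coefficients of the quadratic equation for `v` into `E‴`.
    θ∈ : θ ∈ Generated E′ F∪t
    θ∈ = quotient∈ E′ κφd*[t²ᵖ+1]≉0 (*∈ (κ∈ _) (+∈ (*∈ (^∈ E′ t∈ p) (^∈ E′ t∈ p)) 1∈))
      (*∈ (κ∈ _) (^∈ E′ (+∈ (*∈ t∈ t∈) 1∈) p)) θ-relation

  open θ-Properties using (θ-relation; κ∈; t∈; θ∈)

  -- The quadratic equation of v over π(E‴)

  open LeviCivita G
  private module E‴ = Field E‴

  κ‴ : F.Carrier → E‴.Carrier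
  κ‴ r = ⟦ κ ⟧ r , κ∈ r

  t‴ θ‴ : E‴.Carrier
  t‴ = t , t∈
  θ‴ = θₚ F p φₚ d R , θ∈

  κ‴-≉0 : ∀ {r} → ¬ r F.≈ F.0# → ¬ κ‴ r E‴.≈ E‴.0#
  κ‴-≉0 = FieldHom.≉0-homo F.field′ κ (Field.1≉0 E′)

  open Field L′
  open FieldProperties L′
  open SetoidReasoning setoid
  open ExpProperties commutativeSemiring using (^-congˡ; ^-distrib-*)
  open IntegerSolver ⌊ L′ ⌋
  open Hom π′ using () renaming
    (⟦⟧-cong to π-cong; +-homo to π-+; *-homo to π-*; 1#-homo to π-1)

  private
    module E′ = Field E′

  π₀ : Hom ⌊ E‴ ⌋ ⌊ L′ ⌋
  π₀ = π′ ∘ₕ E‴⊂E′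

  φ₀ : Fin 2 → Hom ⌊ E‴ ⌋ ⌊ L′ ⌋
  φ₀ i = φ′ i ∘ₕ E‴⊂E′

  S : Pred Carrier ℓ
  S y = (∃[ e ] y ≈ ⟦ π₀ ⟧ e) ⊎ y ≈ v

  τ T θ : Carrier
  τ = ⟦ π′ ⟧ t
  T = τ ^ p
  θ = ⟦ π′ ⟧ (θₚ F p φₚ d R)

  θ≈2v²+2v+1 : θ ≈ v * v + v * v + v + v + 1#
  θ≈2v²+2v+1 = trans (sym (x-y≈0⇒x≈y _ _ v-root))
    -- The left side is the polynomial of `v-root` with its powers and multiples unfolded.
    (solve 1 (λ v → let v² = v :* (v :* con (+ 1)) in
      (v² :+ (v² :+ con (+ 0))) :+ (v :+ (v :+ con (+ 0))) :+ con (+ 1)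
        := v :* v :+ v :* v :+ v :+ v :+ con (+ 1)) refl v)

  π-tᵖ : ⟦ π′ ⟧ (t E′.^ p) ≈ T
  π-tᵖ = HomProperties.^-homo π′ t p

  π-t²ᵖ+1 : ⟦ π′ ⟧ (t E′.^ p E′.* t E′.^ p E′.+ E′.1#) ≈ T * T + 1#
  π-t²ᵖ+1 = trans (π-+ _ _) (+-cong (trans (π-* _ _) (*-cong π-tᵖ π-tᵖ)) π-1)

  T*T+1≉0 : ¬ T * T + 1# ≈ 0#
  T*T+1≉0 eq = FieldHom.≉0-homo E′ π′ 1≉0 (t²ᵖ+1≉0 p) (trans π-t²ᵖ+1 eq)

  θ-relation-L′ : θ * (⟦ π′ ⟧ (⟦ κ ⟧ (φₚ F.⟨$⟩ d)) * (T * T + 1#)) ≈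
                  ⟦ π′ ⟧ (⟦ κ ⟧ (d F.^ p)) * (τ * τ + 1#) ^ p
  θ-relation-L′ = begin
    θ * (⟦ π′ ⟧ (⟦ κ ⟧ (φₚ F.⟨$⟩ d)) * (T * T + 1#))
      ≈⟨ trans (π-* _ _) (*-congˡ (trans (π-* _ _) (*-congˡ π-t²ᵖ+1))) ⟨
    ⟦ π′ ⟧ (θₚ F p φₚ d R E′.* (⟦ κ ⟧ (φₚ F.⟨$⟩ d) E′.* (t E′.^ p E′.* t E′.^ p E′.+ E′.1#)))
      ≈⟨ π-cong θ-relation ⟩
    ⟦ π′ ⟧ (⟦ κ ⟧ (d F.^ p) E′.* (t E′.* t E′.+ E′.1#) E′.^ p)
      ≈⟨ trans (π-* _ _) (*-congˡ (trans (HomProperties.^-homo π′ _ p)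
           (^-congˡ p (trans (π-+ _ _) (+-cong (π-* _ _) π-1))))) ⟩
    ⟦ π′ ⟧ (⟦ κ ⟧ (d F.^ p)) * (τ * τ + 1#) ^ p  ∎

  open Horner E‴ L′ π₀ v using () renaming (Relation to π-Relation)

  -- The equation 2 v² + 2 v + (1 - θ) = 0, whose leading coefficient is nonzero in characteristic
  -- 0.
  v-relation : π-Relation 2
  v-relation = 2‴ , κ‴-≉0 (1+1≉0 F) ,
    Horner.horner (E‴.1# E‴.- θ‴) (Horner.horner 2‴ (Horner.constant refl) refl) (sym (begin
      (⟦ π₀ ⟧ 2‴ * v + ⟦ π₀ ⟧ 2‴) * v + ⟦ π₀ ⟧ (E‴.1# E‴.- θ‴)
        ≈⟨ +-cong (*-congʳ (+-cong (*-congʳ π₀-2) π₀-2)) (trans (HomProperties.minus-homo π₀ E‴.1# θ‴)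
             (+-cong π-1 (-‿cong θ≈2v²+2v+1))) ⟩
      ((1# + 1#) * v + (1# + 1#)) * v + (1# - (v * v + v * v + v + v + 1#))
        ≈⟨ solve 1 (λ v → let 2′ = con (+ 1) :+ con (+ 1) in
             (2′ :* v :+ 2′) :* v :+ (con (+ 1) :- (v :* v :+ v :* v :+ v :+ v :+ con (+ 1)))
               := con (+ 0)) refl v ⟩
      0#  ∎))
    where
    2‴ = κ‴ (F.1# F.+ F.1#)
    π₀-2 : ⟦ π₀ ⟧ 2‴ ≈ 1# + 1#
    π₀-2 = trans (π-cong (Hom.+-homo κ _ _))
      (trans (π-+ _ _) (+-cong κ-1 κ-1))
      where
      κ-1 : ⟦ π′ ⟧ (⟦ κ ⟧ F.1#) ≈ 1#
      κ-1 = trans (π-cong (Hom.1#-homo κ)) π-1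

  -- Relations between s, T and v

  module _ (i : Fin 2) where
    private
      e : Carrier
      e = ε ⌊ L′ ⌋ i

      e²≈1 : e * e ≈ 1#
      e²≈1 = ε*ε≈1 ⌊ L′ ⌋ i

      e²-1≈0 : e * e - 1# ≈ 0#
      e²-1≈0 = x≈y⇒x-y≈0 e²≈1

    s D : Carrier
    s = ⟦ φ′ i ⟧ t
    D = s * T + 1# - e * (T - s)

    φ-α : ⟦ φ′ i ⟧ α ≈ αᵖ * u - βᵖ * (e * v)
    φ-α = trans (φ′-on-αβ i zero zero) (entry i)
      where
      entry : ∀ i → (matrix₂ αᵖ βᵖ (- βᵖ) αᵖ ⊗ twist L′ u v i) zero zero ≈
                    αᵖ * u - βᵖ * (ε ⌊ L′ ⌋ i * v)
      entry zero       = solve 4 (λ a b u v →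
        a :* u :+ (b :* (:- v) :+ con (+ 0)) := a :* u :- b :* (con (+ 1) :* v)) refl αᵖ βᵖ u v
      entry (suc zero) = solve 4 (λ a b u v →
        a :* u :+ (b :* v :+ con (+ 0)) := a :* u :- b :* ((:- con (+ 1)) :* v)) refl αᵖ βᵖ u v

    φ-β : ⟦ φ′ i ⟧ β ≈ αᵖ * (e * v) + βᵖ * u
    φ-β = trans (φ′-on-αβ i zero (suc zero)) (entry i)
      where
      entry : ∀ i → (matrix₂ αᵖ βᵖ (- βᵖ) αᵖ ⊗ twist L′ u v i) zero (suc zero) ≈
                    αᵖ * (ε ⌊ L′ ⌋ i * v) + βᵖ * u
      entry zero       = solve 4 (λ a b u v →
        a :* v :+ (b :* u :+ con (+ 0)) := a :* (con (+ 1) :* v) :+ b :* u) refl αᵖ βᵖ u v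
      entry (suc zero) = solve 4 (λ a b u v →
        a :* (:- v) :+ (b :* u :+ con (+ 0)) := a :* ((:- con (+ 1)) :* v) :+ b :* u) refl αᵖ βᵖ u v

    private
      αᵖ≈Tβᵖ : αᵖ ≈ T * βᵖ
      αᵖ≈Tβᵖ = trans (^-congˡ p (trans (π-cong (E′.sym t*β≈α)) (π-* _ _))) (^-distrib-* _ _ p)

      φ-β≈ : ⟦ φ′ i ⟧ β ≈ βᵖ * (T * (e * v) + u)
      φ-β≈ = trans φ-β (trans (+-congʳ (*-congʳ αᵖ≈Tβᵖ))
        (solve 4 (λ T b w u → T :* b :* w :+ b :* u := b :* (T :* w :+ u)) refl T βᵖ (e * v) u))

      φ-α≈ : ⟦ φ′ i ⟧ α ≈ βᵖ * (T * u - e * v)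
      φ-α≈ = trans φ-α (trans (+-congʳ (*-congʳ αᵖ≈Tβᵖ))
        (solve 4 (λ T b w u → T :* b :* u :- b :* w := b :* (T :* u :- w)) refl T βᵖ (e * v) u))

      βᵖ≉0 : ¬ βᵖ ≈ 0#
      βᵖ≉0 = ^-≉0 (FieldHom.≉0-homo E′ π′ 1≉0 β≉0) p

    -- βᵖ times this element is φ′ᵢ(β), the image of a nonzero element.
    s-denominator≉0 : ¬ T * (e * v) + u ≈ 0#
    s-denominator≉0 eq = FieldHom.≉0-homo E′ (φ′ i) 1≉0 β≉0
      (trans φ-β≈ (trans (*-congˡ eq) (zeroʳ _)))

    -- Multiplied by βᵖ, the two sides are s φ′ᵢ(β) and φ′ᵢ(α).
    s-relation : s * (T * (e * v) + u) ≈ T * u - e * v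
    s-relation = *-cancelˡ βᵖ≉0 (begin
      βᵖ * (s * (T * (e * v) + u))    ≈⟨ solve 3 (λ b s x → b :* (s :* x) := s :* (b :* x)) refl βᵖ s _ ⟩
      s * (βᵖ * (T * (e * v) + u))    ≈⟨ *-congˡ φ-β≈ ⟨
      s * ⟦ φ′ i ⟧ β                  ≈⟨ Hom.*-homo (φ′ i) t β ⟨
      ⟦ φ′ i ⟧ (t E′.* β)             ≈⟨ Hom.⟦⟧-cong (φ′ i) t*β≈α ⟩
      ⟦ φ′ i ⟧ α                      ≈⟨ φ-α≈ ⟩
      βᵖ * (T * u - e * v)            ∎)

    -- `s-relation` with u = 1 + v is linear in `v`. Collecting the terms in `v` and multiplying by
    -- `e`, where e² = 1, solves it.
    v*D≈e*[T-s] : v * D ≈ e * (T - s)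
    v*D≈e*[T-s] = x≈y+multiple e (x≈y⇒x-y≈0 s-relation)
      (x≈y+multiple (- (s * T * v + v)) e²-1≈0
        (solve 4 (λ s T e v → let u = con (+ 1) :+ v in
          v :* (s :* T :+ con (+ 1) :- e :* (T :- s))
            := e :* (T :- s) :+ e :* (s :* (T :* (e :* v) :+ u) :- (T :* u :- e :* v))
               :+ (:- (s :* T :* v :+ v)) :* (e :* e :- con (+ 1))) refl s T e v))

    -- If D = 0, then `v*D≈e*[T-s]` gives T = s, and T² + 1 = D + (T + e) (T - s) would vanish.
    D≉0 : ¬ D ≈ 0#
    D≉0 D≈0 = T*T+1≉0 (x≈y+multiple 1# D≈0 (x≈y+multiple (T + e) T-s≈0
      (solve 3 (λ s T e → T :* T :+ con (+ 1)
        := con (+ 0) :+ con (+ 1) :* (s :* T :+ con (+ 1) :- e :* (T :- s))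
           :+ (T :+ e) :* (T :- s)) refl s T e)))
      where
      T-s≈0 : T - s ≈ 0#
      T-s≈0 = begin
        T - s              ≈⟨ *-identityˡ _ ⟨
        1# * (T - s)       ≈⟨ *-congʳ e²≈1 ⟨
        e * e * (T - s)    ≈⟨ *-assoc _ _ _ ⟩
        e * (e * (T - s))  ≈⟨ *-congˡ v*D≈e*[T-s] ⟨
        e * (v * D)        ≈⟨ *-congˡ (*-congˡ D≈0) ⟩
        e * (v * 0#)       ≈⟨ trans (*-congˡ (zeroʳ v)) (zeroʳ e) ⟩
        0#                 ∎

    -- θ = v² + (v + 1)² is a sum of two squares, so θ D² = (v D)² + (v D + D)². Here v D = e (T -
    -- s) and v D + D = s T + 1, and (T - s)² + (s T + 1)² = (s² + 1) (T² + 1).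
    θ*D² : θ * (D * D) ≈ (s * s + 1#) * (T * T + 1#)
    θ*D² = begin
      θ * (D * D)
        ≈⟨ *-congʳ θ≈2v²+2v+1 ⟩
      (v * v + v * v + v + v + 1#) * (D * D)
        ≈⟨ solve 2 (λ v D → (v :* v :+ v :* v :+ v :+ v :+ con (+ 1)) :* (D :* D)
             := v :* D :* (v :* D) :+ (v :* D :+ D) :* (v :* D :+ D)) refl v D ⟩
      v * D * (v * D) + (v * D + D) * (v * D + D)
        ≈⟨ +-cong (*-cong v*D≈e*[T-s] v*D≈e*[T-s])
             (*-cong (+-congʳ v*D≈e*[T-s]) (+-congʳ v*D≈e*[T-s])) ⟩
      e * (T - s) * (e * (T - s)) + (e * (T - s) + D) * (e * (T - s) + D)
        ≈⟨ x≈y+multiple ((T - s) * (T - s)) e²-1≈0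
             (solve 3 (λ s T e → let w = e :* (T :- s) ; D = s :* T :+ con (+ 1) :- w in
               w :* w :+ (w :+ D) :* (w :+ D)
                 := (s :* s :+ con (+ 1)) :* (T :* T :+ con (+ 1))
                    :+ (T :- s) :* (T :- s) :* (e :* e :- con (+ 1))) refl s T e) ⟩
      (s * s + 1#) * (T * T + 1#)  ∎

    module _ {S′ : Pred Carrier ℓ} where
      private
        e∈ : e ∈ Generated L′ S′
        e∈ = ε∈ i
          where
          ε∈ : ∀ i → ε ⌊ L′ ⌋ i ∈ Generated L′ S′
          ε∈ zero    = 1∈
          ε∈ (suc _) = -∈ 1∈

      -- Over any subfield containing `τ`, each of `v` and `s` determines the other; this direction
      -- divides by `D`, and `s∈` by the denominator of `s`.
      v∈ : τ ∈ Generated L′ S′ → s ∈ Generated L′ S′ → v ∈ Generated L′ S′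
      v∈ τ∈ s∈ = quotient∈ L′ D≉0 (+∈ (+∈ (*∈ s∈ T∈) 1∈) (-∈ eTs∈)) eTs∈ v*D≈e*[T-s]
        where
        T∈ = ^∈ L′ τ∈ p
        eTs∈ = *∈ e∈ (+∈ T∈ (-∈ s∈))

      s∈ : τ ∈ Generated L′ S′ → v ∈ Generated L′ S′ → s ∈ Generated L′ S′
      s∈ τ∈ v∈ = quotient∈ L′ s-denominator≉0
        (+∈ (*∈ T∈ (*∈ e∈ v∈)) u∈) (+∈ (*∈ T∈ u∈) (-∈ (*∈ e∈ v∈))) s-relation
        where
        T∈ = ^∈ L′ τ∈ p
        u∈ = +∈ 1∈ v∈

  -- Generators of the compositum

  π∈ : ∀ x → ⟦ π₀ ⟧ x ∈ Generated L′ S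
  π∈ x = gen (inj₁ (x , refl))

  φ∈ : ∀ i x → ⟦ φ₀ i ⟧ x ∈ Generated L′ S
  φ∈ i (x , x∈) = Generated-map L′ E′ (φ′ i) generators x∈
    where
    generators : ∀ {x} → x ∈ F∪t → ⟦ φ′ i ⟧ x ∈ Generated L′ S
    generators (inj₁ (r , x≈κr)) = resp
      (sym (trans (Hom.⟦⟧-cong (φ′ i) x≈κr) (φ′-on-F i r))) (π∈ (κ‴ (φₚ F.⟨$⟩ r)))
    generators (inj₂ x≈t) = resp
      (sym (Hom.⟦⟧-cong (φ′ i) x≈t)) (s∈ i (π∈ t‴) (gen (inj₂ refl)))

  module _ (i : Fin 2) where

    S⊆compositum : S ⊆ Generated L′ (λ y → (∃[ e ] y ≈ ⟦ π₀ ⟧ e) ⊎ (∃[ e ] y ≈ ⟦ φ₀ i ⟧ e))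
    S⊆compositum (inj₁ (e , y≈)) = gen (inj₁ (e , y≈))
    S⊆compositum (inj₂ y≈v)      = resp (sym y≈v)
      (v∈ i (gen (inj₁ (t‴ , refl))) (gen (inj₂ (t‴ , refl))))

    -- Since φ′ᵢ acts on `F` through φₚ, surjectivity of φₚ puts all constants of `F` into φ′ᵢ(E‴).
    φₚ-preimage : ∀ r → ∃[ r′ ] φₚ F.⟨$⟩ r′ F.≈ r
    φₚ-preimage r =
      let (r′ , φr′≈r) = IsRingIsomorphism.surjective (F.Gal.isIsomorphism φₚ) r
      in r′ , φr′≈r F.refl

    φ₀-κ‴ : ∀ r → ⟦ φ₀ i ⟧ (κ‴ r) ≈ ⟦ π′ ⟧ (⟦ κ ⟧ (φₚ F.⟨$⟩ r))
    φ₀-κ‴ = φ′-on-F i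

    -- Over φ′ᵢ(E‴) the single element `τ` generates the compositum: the constants are already
    -- present, and `v` is recovered from `τ` and `s`.
    S⊆φ[t] : S ⊆ Generated L′ (λ y → (∃[ e ] y ≈ ⟦ φ₀ i ⟧ e) ⊎ y ≈ τ)
    S⊆φ[t] (inj₂ y≈v) = resp (sym y≈v) (v∈ i (gen (inj₂ refl)) (gen (inj₁ (t‴ , refl))))
    S⊆φ[t] (inj₁ ((x , x∈) , y≈)) = resp (sym y≈) (Generated-map L′ E′ π′ generators x∈)
      where
      generators : ∀ {x} → x ∈ F∪t → ⟦ π′ ⟧ x ∈ Generated L′ (λ y → (∃[ e ] y ≈ ⟦ φ₀ i ⟧ e) ⊎ y ≈ τ)
      generators (inj₁ (r , x≈κr)) = let (r′ , φr′≈r) = φₚ-preimage r in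
        gen (inj₁ (κ‴ r′ , trans (π-cong (E′.trans x≈κr (Hom.⟦⟧-cong κ (F.sym φr′≈r)))) (sym (φ₀-κ‴ r′))))
      generators (inj₂ x≈t) = gen (inj₂ (π-cong x≈t))

    -- A polynomial relation for τ over φ′ᵢ(E‴)

    private
      module Φ = Hom (φ₀ i)
      open Horner E‴ L′ (φ₀ i) τ

      -- Chosen with φₚ(d′) = dᵖ, so that dᵖ is the image of a coefficient in `E‴` under `φ₀ i`.
      d′ : F.Carrier
      d′ = proj₁ (φₚ-preimage (d F.^ p))

      d′≉0 : ¬ d′ F.≈ F.0#
      d′≉0 d′≈0 = FF.^-≉0 d≉0 p (F.trans (F.sym (proj₂ (φₚ-preimage (d F.^ p))))
        (F.trans (Hom.⟦⟧-cong (F.Gal.hom φₚ) d′≈0) (Hom.0#-homo (F.Gal.hom φₚ))))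

      ε‴ : E‴.Carrier
      ε‴ = ε ⌊ E‴ ⌋ i

      t²+1 t-ε : E‴.Carrier
      t²+1 = t‴ E‴.* t‴ E‴.+ E‴.1#
      t-ε  = t‴ E‴.- ε‴

      -- The coefficients of `X` and `Y` at τ⁴ᵖ, with the factors 1 kept as `Lead-*` and `Lead-^`
      -- produce them.
      c₁ c₂ : E‴.Carrier
      c₁ = (κ‴ d E‴.* t²+1) E‴.* ((E‴.1# E‴.* E‴.1#) E‴.* (E‴.1# E‴.* E‴.1#))
      c₂ = κ‴ d′ E‴.* ((E‴.1# E‴.* E‴.1#) E‴.^ p E‴.* ((t-ε E‴.* E‴.1#) E‴.* (t-ε E‴.* E‴.1#)))

      -- The two sides of the relation obtained by eliminating θ, written over φ′ᵢ(E‴). `D` is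
      -- regrouped as the polynomial (s - ε) T + (1 + ε s) in T.
      X Y : Carrier
      X = ⟦ φ₀ i ⟧ (κ‴ d E‴.* t²+1) * ((T * T + ⟦ φ₀ i ⟧ E‴.1#) * (T * T + ⟦ φ₀ i ⟧ E‴.1#))
      Y = ⟦ φ₀ i ⟧ (κ‴ d′) * ((τ * τ + ⟦ φ₀ i ⟧ E‴.1#) ^ p * (D′ * D′))
        where
        D′ = ⟦ φ₀ i ⟧ t-ε * T + ⟦ φ₀ i ⟧ (E‴.1# E‴.+ ε‴ E‴.* t‴)

      p*2≡p+p : p ℕ.* 2 ≡ p ℕ.+ p
      p*2≡p+p = ≡.trans (ℕ.*-comm p 2) (≡.cong (p ℕ.+_) (ℕ.+-identityʳ p))

      X-lead : Lead ((p ℕ.+ p) ℕ.+ (p ℕ.+ p)) c₁ X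
      X-lead = Lead-scale _ (Lead-* T²+1-lead T²+1-lead)
        where
        T²+1-lead : Lead (p ℕ.+ p) (E‴.1# E‴.* E‴.1#) (T * T + ⟦ φ₀ i ⟧ E‴.1#)
        T²+1-lead = Lead-+const E‴.1# (Lead-* (Lead-t^ p) (Lead-t^ p))

      Y-lead : Lead ((p ℕ.+ p) ℕ.+ (p ℕ.+ p)) c₂ Y
      Y-lead = Lead-scale _ (Lead-* τ²+1-lead (Lead-* D-lead D-lead))
        where
        τ-lead : Lead 1 E‴.1# τ
        τ-lead = Lead-resp (E‴.refl {E‴.1#}) (*-identityʳ τ) (Lead-t^ 1)
        τ²+1-lead : Lead (p ℕ.+ p) ((E‴.1# E‴.* E‴.1#) E‴.^ p) ((τ * τ + ⟦ φ₀ i ⟧ E‴.1#) ^ p)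
        τ²+1-lead = ≡.subst (λ n → Lead n ((E‴.1# E‴.* E‴.1#) E‴.^ p) ((τ * τ + ⟦ φ₀ i ⟧ E‴.1#) ^ p))
          p*2≡p+p (Lead-^ (Lead-+const E‴.1# (Lead-* τ-lead τ-lead)) p)
        D-lead = Lead-+const (E‴.1# E‴.+ ε‴ E‴.* t‴) (Lead-scale t-ε (Lead-t^ p))

      -- Both sides equal θ D² φₚ(d) (T² + 1), by `θ*D²` on one side and `θ-relation-L′` on the
      -- other.
      X≈Y : X ≈ Y
      X≈Y = begin
        X
          ≈⟨ *-cong (trans (Φ.*-homo (κ‴ d) t²+1) (*-cong (φ₀-κ‴ d)
               (trans (Φ.+-homo (t‴ E‴.* t‴) E‴.1#) (+-cong (Φ.*-homo t‴ t‴) Φ.1#-homo))))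
               (*-cong (+-congˡ Φ.1#-homo) (+-congˡ Φ.1#-homo)) ⟩
        φd * (s i * s i + 1#) * ((T * T + 1#) * (T * T + 1#))
          ≈⟨ solve 3 (λ f s T → f :* s :* (T :* T) := s :* T :* (f :* T)) refl φd _ (T * T + 1#) ⟩
        (s i * s i + 1#) * (T * T + 1#) * (φd * (T * T + 1#))
          ≈⟨ *-congʳ (θ*D² i) ⟨
        θ * (D i * D i) * (φd * (T * T + 1#))
          ≈⟨ solve 3 (λ θ D f → θ :* D :* f := θ :* f :* D) refl θ (D i * D i) _ ⟩
        θ * (φd * (T * T + 1#)) * (D i * D i)
          ≈⟨ *-congʳ θ-relation-L′ ⟩
        ⟦ π′ ⟧ (⟦ κ ⟧ (d F.^ p)) * (τ * τ + 1#) ^ p * (D i * D i)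
          ≈⟨ *-assoc _ _ _ ⟩
        ⟦ π′ ⟧ (⟦ κ ⟧ (d F.^ p)) * ((τ * τ + 1#) ^ p * (D i * D i))
          ≈⟨ *-cong (trans (φ₀-κ‴ d′) (π-cong (Hom.⟦⟧-cong κ (proj₂ (φₚ-preimage (d F.^ p))))))
               (*-cong (^-congˡ p (+-congˡ Φ.1#-homo)) (*-cong D≈ D≈)) ⟨
        Y  ∎
        where
        φd = ⟦ π′ ⟧ (⟦ κ ⟧ (φₚ F.⟨$⟩ d))
        D≈ : ⟦ φ₀ i ⟧ t-ε * T + ⟦ φ₀ i ⟧ (E‴.1# E‴.+ ε‴ E‴.* t‴) ≈ D i
        D≈ = begin
          ⟦ φ₀ i ⟧ t-ε * T + ⟦ φ₀ i ⟧ (E‴.1# E‴.+ ε‴ E‴.* t‴)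
            ≈⟨ +-cong (*-congʳ (trans (HomProperties.minus-homo (φ₀ i) t‴ ε‴) (+-congˡ (-‿cong (ε-homo (φ₀ i) i)))))
                 (trans (Φ.+-homo E‴.1# (ε‴ E‴.* t‴))
                   (+-cong Φ.1#-homo (trans (Φ.*-homo ε‴ t‴) (*-congʳ (ε-homo (φ₀ i) i))))) ⟩
          (s i - ε ⌊ L′ ⌋ i) * T + (1# + ε ⌊ L′ ⌋ i * s i)
            ≈⟨ solve 3 (λ s T e → (s :- e) :* T :+ (con (+ 1) :+ e :* s)
                 := s :* T :+ con (+ 1) :- e :* (T :- s)) refl (s i) T (ε ⌊ L′ ⌋ i) ⟩
          D i  ∎

    -- c₁ - c₂ = d (t² + 1) - d′ (t - ε)², where φₚ(d′) = dᵖ, has the coefficients d - d′ and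
    -- 2 ε d′ at t² and t.
    leadingCoefficient≉0 : ¬ c₁ E‴.- c₂ E‴.≈ E‴.0#
    leadingCoefficient≉0 c≈0 = *ε-≉0 d′≉0 (t-transcendental linear)
      where
      module T = Horner F.field′ E′ κ t
      module SE = IntegerSolver ⌊ E′ ⌋
      module FE = FieldProperties E′
      εF = ε F.commutativeRing i
      εE = ε ⌊ E′ ⌋ i
      κd  = ⟦ κ ⟧ d
      κd′ = ⟦ κ ⟧ d′

      *ε-≉0 : ∀ {x} → ¬ x F.≈ F.0# → ¬ (F.1# F.+ F.1#) F.* (εF F.* x) F.≈ F.0#
      *ε-≉0 x≉0 = FF.*-≉0 (1+1≉0 F) (FF.*-≉0
        (FF.x*y≈1⇒x≉0 (ε*ε≈1 F.commutativeRing i)) x≉0)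

      1^n≈1 : ∀ n → proj₁ ((E‴.1# E‴.* E‴.1#) E‴.^ n) E′.≈ E′.1#
      1^n≈1 ℕ.zero    = E′.refl
      1^n≈1 (ℕ.suc n) =
        E′.trans (E′.*-cong (E′.*-identityˡ _) (1^n≈1 n)) (E′.*-identityˡ _)

      δ m : E′.Carrier
      δ = κd E′.- κd′
      m = (E′.1# E′.+ E′.1#) E′.* (εE E′.* κd′)

      expand : proj₁ (c₁ E‴.- c₂) E′.≈ (δ E′.* t E′.+ m) E′.* t E′.+ δ
      expand = E′.trans
        (E′.+-congˡ (E′.-‿cong (E′.*-congˡ (E′.*-cong (1^n≈1 p)
          (E′.*-cong t-ε≈ t-ε≈)))))
        (FE.x≈y+multiple (E′.- κd′) (FE.x≈y⇒x-y≈0 (ε*ε≈1 ⌊ E′ ⌋ i))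
          (SE.solve 4 (λ a b t e → let 1′ = SE.con (+ 1) ; t-e = (t SE.:- e) SE.:* 1′ in
            (a SE.:* (t SE.:* t SE.:+ 1′)) SE.:* ((1′ SE.:* 1′) SE.:* (1′ SE.:* 1′))
              SE.:- b SE.:* (1′ SE.:* (t-e SE.:* t-e))
            SE.:= ((a SE.:- b) SE.:* t SE.:+ (1′ SE.:+ 1′) SE.:* (e SE.:* b)) SE.:* t
              SE.:+ (a SE.:- b) SE.:+ (SE.:- b) SE.:* (e SE.:* e SE.:- 1′)) E′.refl κd κd′ t εE))
        where
        t-ε≈ : proj₁ (t-ε E‴.* E‴.1#) E′.≈ (t E′.- εE) E′.* E′.1#
        t-ε≈ = E′.*-congʳ (E′.+-congˡ (E′.-‿cong (ε-homo E‴⊂E′ i)))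

      κ-δ : ⟦ κ ⟧ (d F.- d′) E′.≈ δ
      κ-δ = HomProperties.minus-homo κ d d′

      κ-m : ⟦ κ ⟧ ((F.1# F.+ F.1#) F.* (εF F.* d′)) E′.≈ m
      κ-m = E′.trans (Hom.*-homo κ _ _) (E′.*-cong
        (E′.trans (Hom.+-homo κ _ _) (E′.+-cong (Hom.1#-homo κ) (Hom.1#-homo κ)))
        (E′.trans (Hom.*-homo κ _ _) (E′.*-congʳ (ε-homo κ i))))

      0≈quadratic : E′.0# E′.≈ (δ E′.* t E′.+ m) E′.* t E′.+ δ
      0≈quadratic = E′.trans (E′.sym c≈0) expand

      -- Transcendence of `t` first annihilates the coefficient at t². The polynomial then shortens
      -- to degree 1, with leading coefficient 2 ε d′.
      d≈d′ : d F.- d′ F.≈ F.0#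
      d≈d′ = t-transcendental (T.horner (d F.- d′)
        (T.horner ((F.1# F.+ F.1#) F.* (εF F.* d′)) (T.constant E′.refl) E′.refl)
        (E′.trans 0≈quadratic
          (E′.sym (E′.+-cong (E′.*-congʳ (E′.+-cong (E′.*-congʳ κ-δ) κ-m)) κ-δ))))

      linear : T.Lead 1 ((F.1# F.+ F.1#) F.* (εF F.* d′)) E′.0#
      linear = T.horner (d F.- d′) (T.constant E′.refl)
        (E′.trans 0≈quadratic (E′.+-cong (E′.*-congʳ δt+m≈) (E′.sym κ-δ)))
        where
        δ≈0 : δ E′.≈ E′.0#
        δ≈0 = E′.trans (E′.sym κ-δ) (E′.trans (Hom.⟦⟧-cong κ d≈d′) (Hom.0#-homo κ))
        δt+m≈ : δ E′.* t E′.+ m E′.≈ ⟦ κ ⟧ ((F.1# F.+ F.1#) F.* (εF F.* d′))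
        δt+m≈ = E′.trans (E′.+-congʳ (E′.trans (E′.*-congʳ δ≈0) (E′.zeroˡ t)))
          (E′.trans (E′.+-identityˡ m) (E′.sym κ-m))

    φ-relation : Relation ((p ℕ.+ p) ℕ.+ (p ℕ.+ p))
    φ-relation = c₁ E‴.- c₂ , leadingCoefficient≉0 ,
      Lead-resp (E‴.refl {c₁ E‴.- c₂}) (x≈y⇒x-y≈0 X≈Y) (Lead-- X-lead Y-lead)

    -- A single field, so there is one factor. It is spanned by 1 and `v` over π(E‴), and by the
    -- powers of `τ` below degree 4p over φ′ᵢ(E‴).
    Γ̄-object : 𝒞₀ (Compositum.Γ̄ E‴ L′ π₀ (φ₀ i) S π∈ (φ∈ i))
    Γ̄-object = record
      { size            = 1
      ; factor          = λ _ → subfield L′ S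
      ; proj            = λ _ → idₕ ⌊ subfield L′ S ⌋
      ; proj-injective  = λ _ _ x≈y → x≈y zero
      ; proj-surjective = λ f → f zero , λ { zero → refl }
      ; π-finite        = λ _ → Horner.corestrict-isFinite E‴ L′ π₀ v v-relation S π∈
                                  (gen (inj₂ refl)) gen
      ; φ-finite        = corestrict-isFinite φ-relation S (φ∈ i) (π∈ t‴) S⊆φ[t]
      }

-- Existence and uniqueness of the reduced correspondences

proposition3p19 : ∀ {ℓ : Level} (F : NumberField ℓ) (let open NumberField F) → IsGalois →
    (M D : ℤ) → + 2 ∣ M → IsDiscriminant D → D ∣ M →
    (p : ℕ) → Prime p → ¬ (+ p ∣ M) →
    (𝔓 : Pred Carrier ℓ) → IsPrimeAbove p 𝒪[1/ M ] 𝔓 →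
    (φₚ : Gal) → IsFrobenius p 𝒪[1/ M ] 𝔓 φₚ →
    (σ : Fin 2 → Gal) → (∀ x → σ zero ⟨$⟩ x ≈ x) →
    (d : Carrier) → IsUnitOf 𝒪[1/ M ] d → σ (suc zero) ⟨$⟩ d ≈ d →
    (R : RationalFunctionField field′) (let open RationalFunctionField R) →
    (G : LeviCivita F p φₚ d R) (let open LeviCivita G) →
    (Σ (CommutativeRing ℓ ℓ) λ 𝒪Y‴ →
    Σ (Hom ⌊ E‴ ⌋ 𝒪Y‴) λ π‴ →
    Σ (Fin 2 → Hom ⌊ E‴ ⌋ 𝒪Y‴) λ φ‴ →
    ∀ i → IsCategoricallyReduced (correspondence {E = E‴} 𝒪Y‴ π‴ (φ‴ i))
    × (Γ′ₚ i ↠[ E‴⊂E′ ] correspondence {E = E‴} 𝒪Y‴ π‴ (φ‴ i)))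
    ×
    (∀ i (Γ₁ Γ₂ : Correspondence E‴) → IsCategoricallyReduced Γ₁ → IsCategoricallyReduced Γ₂ →
    (m₁ : Γ′ₚ i ↠[ E‴⊂E′ ] Γ₁) (m₂ : Γ′ₚ i ↠[ E‴⊂E′ ] Γ₂) →
    Σ (Γ₁ ↠ Γ₂) λ j → IsIso j ×
    (∀ y → Field._≈_ (LeviCivita.L′ G) (⟦ v♯ m₁ ⟧ (⟦ v♯ j ⟧ y)) (⟦ v♯ m₂ ⟧ y)))
-- Excluding 0 lets `p` be written as a successor, which makes the degrees in `t` positive.
proposition3p19 _ _ _ _ _ _ _ ℕ.zero p-prime = contradiction p-prime ¬prime[0]
proposition3p19 F _ _ _ _ _ _ (ℕ.suc p-1) _ _ _ _ φₚ _ _ _ d (_ , _ , _ , dd⁻¹≈1) _ R G =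
  -- `S` does not involve `i`, so the ring and the first projection are common to both
  -- correspondences.
  ( ⌊ subfield L′ S ⌋
  , corestrict L′ S π₀ π∈
  , (λ i → corestrict L′ S (φ₀ i) (φ∈ i))
  , λ i → categoricallyReduced i (S⊆compositum i) (Γ̄-object i) , project i )
  , λ i Γ₁ Γ₂ → unique i (S⊆compositum i) Γ₁ Γ₂ (Γ̄-object i)
  where
  open RationalFunctionField R using (E‴)
  open LeviCivita G using (L′)
  open LeviCivitaProperties F p-1 φₚ d
    (FieldProperties.x*y≈1⇒x≉0 (NumberField.field′ F) dd⁻¹≈1) R G
  module _ (i : Fin 2) where
    open Compositum E‴ L′ π₀ (φ₀ i) S π∈ (φ∈ i) public
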